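{- Let $n\ge 0$ and let $A=(A_{ij})_{1\le i,j\le 2n}$ be a generic skew-symmetric matrix of size $2n$ (the entries $A_{ij}$ with $i<j$ are independent indeterminates, and $\lambda$ is a further indeterminate). Let $\operatorname{Pf}_\lambda(A)$ be the $\lambda$-Pfaffian defined recursively by $$\operatorname{Pf}_\lambda(())=1,\qquad \operatorname{Pf}_\lambda\begin{pmatrix}0&a\\-a&0\end{pmatrix}=a,$$ and, for size $2n$ with $n\ge 2$, $$\operatorname{Pf}_\lambda(A^{(1,2,2n-1,2n)})\operatorname{Pf}_\lambda(A)=\operatorname{Pf}_\lambda(A^{(1,2)})\operatorname{Pf}_\lambda(A^{(2n-1,2n)})-\lambda\operatorname{Pf}_\lambda(A^{(1,2n-1)})\operatorname{Pf}_\lambda(A^{(2,2n)})+\lambda\operatorname{Pf}_\lambda(A^{(1,2n)})\operatorname{Pf}_\lambda(A^{(2,2n-1)}).$$ Then $$\operatorname{Pf}_\lambda(A)=\sum_{m\in\mathcal M([2n])}(-1)^{\mathrm{cross}(m)}\,\lambda^{\mathrm{cross}(m)+\mathrm{nest}(m)}\prod_{i=1}^n A_{m_{2i-1}m_{2i}}.$$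
   Context: $A^{(i_1,\dots,i_r)}$ denotes the matrix obtained from $A$ by deleting the rows and the columns with indices $i_1,\dots,i_r$ (the remaining rows and columns are then relabelled in increasing order, so that the recurrence can be applied to them). $()$ is the empty ($0\times 0$) matrix. The recurrence is read in the field of rational functions in $\lambda$ and the $A_{ij}$, $i<j$: it determines $\operatorname{Pf}_\lambda(A)$ by dividing by $\operatorname{Pf}_\lambda(A^{(1,2,2n-1,2n)})$, a nonzero element of this field. $[2n]=\{1,\dots,2n\}$ and $\mathcal M([2n])$ is the set of perfect matchings of $[2n]$. A perfect matching is written $m=((m_1,m_2),\dots,(m_{2n-1},m_{2n}))$ with $\{m_1,\dots,m_{2n}\}=[2n]$, $m_{2i-1}<m_{2i}$ for all $i$, and $m_1<m_3<\cdots<m_{2n-1}$. $\mathrm{cross}(m)$ is the number of (unordered) pairs of pairs $(a,b),(c,d)$ in $m$ with $a<c<b<d$; $\mathrm{nest}(m)$ is the number of pairs of pairs $(a,b),(c,d)$ in $m$ with $a<c<d<b$. -}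

module Defs where

open import Algebra.Apartness.Bundles using (HeytingCommutativeRing)
import Algebra.Apartness.Properties.HeytingCommutativeRing as HeytingProperties
open import Algebra.Bundles using (CommutativeRing)
import Algebra.Properties.Semiring.Exp as Exponentiation
import Algebra.Properties.CommutativeSemigroup as CommutativeSemigroupProperties
import Algebra.Properties.Ring as RingProperties
import Algebra.Solver.Ring.NaturalCoefficients.Default as SemiringSolver
open import Data.Empty using (⊥-elim)
open import Data.Fin.Base using (Fin; zero; suc; fromℕ; inject₁; punchIn; _<_; _↑ˡ_; _↑ʳ_)
open import Data.Fin.Properties using (_≟_; _<?_; <-cmp; all?)
open import Data.List.Base as List using (List; []; _∷_; allFin; cartesianProduct; cartesianProductWith; filter)
open import Data.Nat.Base as ℕ using (ℕ; zero; suc; s≤s)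
open import Data.Product.Base using (_×_; _,_; proj₁; proj₂)
open import Data.Rational.Base as ℚ using (ℚ; 0ℚ)
import Data.Rational.Properties as ℚ
open import Data.Sum.Base using (_⊎_)
open import Data.Vec.Base as Vec using (Vec; []; _∷_; allPairs; count)
open import Data.Vec.Relation.Unary.All as All using (All)
open import Data.Vec.Relation.Unary.Any as Any using (Any)
open import Data.Vec.Relation.Unary.Linked as Linked using (Linked)
open import Level using (0ℓ; _⊔_) renaming (suc to lsuc)
open import Relation.Binary.Definitions using (Decidable; tri<; tri≈; tri>)
import Relation.Binary.PropositionalEquality as ≡
import Relation.Binary.Reasoning.Setoid as SetoidReasoning
open import Relation.Nullary using (¬_; Dec; yes; no; _×-dec_; _⊎-dec_)
import Relation.Nullary.Decidable as Dec
import Relation.Unary as Unary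

record IntegralDomain c ℓ : Set (lsuc (c ⊔ ℓ)) where
  field
    commutativeRing : CommutativeRing c ℓ
  open CommutativeRing commutativeRing public
  infix 4 _≈?_
  field
    _≈?_            : Decidable _≈_
    1≉0             : 1# ≉ 0#
    *-nonZero       : ∀ {x y} → x ≉ 0# → y ≉ 0# → x * y ≉ 0#

-- The inverse is total, with 0⁻¹ = 0.
record Field c ℓ : Set (lsuc (c ⊔ ℓ)) where
  field
    commutativeRing : CommutativeRing c ℓ
  open CommutativeRing commutativeRing public
  infix 8 _⁻¹
  field
    1≉0             : 1# ≉ 0#
    _⁻¹             : Carrier → Carrier
    ⁻¹-cong         : ∀ {x y} → x ≈ y → x ⁻¹ ≈ y ⁻¹
    ⁻¹-inverseʳ     : ∀ {x} → x ≉ 0# → x * x ⁻¹ ≈ 1#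
    0⁻¹≈0           : 0# ⁻¹ ≈ 0#

  infixl 7 _/_
  _/_ : Carrier → Carrier → Carrier
  x / y = x * y ⁻¹

  open Exponentiation semiring public using (_^_)

  sum product : List Carrier → Carrier
  sum     = List.foldr _+_ 0#
  product = List.foldr _*_ 1#

ℚ-integralDomain : IntegralDomain 0ℓ 0ℓ
ℚ-integralDomain = record
  { commutativeRing = ℚ.+-*-commutativeRing
  ; _≈?_            = ℚ._≟_
  ; 1≉0             = ℚ.1≢0
  ; *-nonZero       = HeytingProperties.x#0y#0→xy#0 ℚ.heytingCommutativeRing
  }

-- A polynomial is a list of coefficients, constant term first. Trailing zeros
-- are allowed, so equality is equality of all coefficients.
module Polynomial {c ℓ} (D : IntegralDomain c ℓ) where
  private
    module D = IntegralDomain D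
    open D using (Carrier; 0#; 1#)
    open RingProperties D.ring using (-0#≈0#)

  Poly : Set c
  Poly = List Carrier

  coeff : Poly → ℕ → Carrier
  coeff []      _       = 0#
  coeff (a ∷ p) zero    = a
  coeff (a ∷ p) (suc k) = coeff p k

  infix 4 _≈_
  record _≈_ (p q : Poly) : Set ℓ where
    constructor coeffwise
    field at : ∀ k → coeff p k D.≈ coeff q k
  open _≈_ public

  infixl 6 _+_
  infixl 7 _*_ _·_
  infix  8 -_

  _+_ : Poly → Poly → Poly
  []      + q       = q
  (a ∷ p) + []      = a ∷ p
  (a ∷ p) + (b ∷ q) = (a D.+ b) ∷ (p + q)

  -_ : Poly → Poly
  -_ = List.map (D.-_)

  _·_ : Carrier → Poly → Poly
  a · p = List.map (a D.*_) p

  _*_ : Poly → Poly → Poly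
  []      * q = []
  (a ∷ p) * q = a · q + (0# ∷ p * q)

  private
    refl : ∀ {p} → p ≈ p
    refl .at _ = D.refl

    sym : ∀ {p q} → p ≈ q → q ≈ p
    sym e .at k = D.sym (e .at k)

    trans : ∀ {p q r} → p ≈ q → q ≈ r → p ≈ r
    trans e f .at k = D.trans (e .at k) (f .at k)

    coeff-+ : ∀ p q k → coeff (p + q) k D.≈ coeff p k D.+ coeff q k
    coeff-+ []      q       k       = D.sym (D.+-identityˡ _)
    coeff-+ (a ∷ p) []      k       = D.sym (D.+-identityʳ _)
    coeff-+ (a ∷ p) (b ∷ q) zero    = D.refl
    coeff-+ (a ∷ p) (b ∷ q) (suc k) = coeff-+ p q k

    coeff-- : ∀ p k → coeff (- p) k D.≈ D.- coeff p k
    coeff-- []      k       = D.sym -0#≈0#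
    coeff-- (a ∷ p) zero    = D.refl
    coeff-- (a ∷ p) (suc k) = coeff-- p k

    coeff-· : ∀ a p k → coeff (a · p) k D.≈ a D.* coeff p k
    coeff-· a []      k       = D.sym (D.zeroʳ a)
    coeff-· a (b ∷ p) zero    = D.refl
    coeff-· a (b ∷ p) (suc k) = coeff-· a p k

    ∷-cong : ∀ {a b p q} → a D.≈ b → p ≈ q → a ∷ p ≈ b ∷ q
    ∷-cong e f .at zero    = e
    ∷-cong e f .at (suc k) = f .at k

    tail-≈0 : ∀ {a p} → a ∷ p ≈ [] → p ≈ []
    tail-≈0 e .at k = e .at (suc k)

    0∷≈0 : ∀ {a p} → a D.≈ 0# → p ≈ [] → a ∷ p ≈ []
    0∷≈0 e f .at zero    = e
    0∷≈0 e f .at (suc k) = f .at k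

    +-cong : ∀ {p p′ q q′} → p ≈ p′ → q ≈ q′ → p + q ≈ p′ + q′
    +-cong {p} {p′} {q} {q′} e f .at k = D.trans (coeff-+ p q k)
      (D.trans (D.+-cong (e .at k) (f .at k)) (D.sym (coeff-+ p′ q′ k)))

    +-assoc : ∀ p q r → (p + q) + r ≈ p + (q + r)
    +-assoc p q r .at k = begin
      coeff ((p + q) + r) k                   ≈⟨ coeff-+ (p + q) r k ⟩
      coeff (p + q) k D.+ coeff r k           ≈⟨ D.+-congʳ (coeff-+ p q k) ⟩
      coeff p k D.+ coeff q k D.+ coeff r k   ≈⟨ D.+-assoc _ _ _ ⟩
      coeff p k D.+ (coeff q k D.+ coeff r k) ≈⟨ D.+-congˡ (coeff-+ q r k) ⟨
      coeff p k D.+ coeff (q + r) k           ≈⟨ coeff-+ p (q + r) k ⟨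
      coeff (p + (q + r)) k                   ∎
      where open SetoidReasoning D.setoid

    +-comm : ∀ p q → p + q ≈ q + p
    +-comm p q .at k = D.trans (coeff-+ p q k)
      (D.trans (D.+-comm _ _) (D.sym (coeff-+ q p k)))

    +-identityʳ : ∀ p → p + [] ≈ p
    +-identityʳ p .at k = D.trans (coeff-+ p [] k) (D.+-identityʳ _)

    -‿cong : ∀ {p q} → p ≈ q → - p ≈ - q
    -‿cong {p} {q} e .at k = D.trans (coeff-- p k)
      (D.trans (D.-‿cong (e .at k)) (D.sym (coeff-- q k)))

    -‿inverseʳ : ∀ p → p + - p ≈ []
    -‿inverseʳ p .at k = D.trans (coeff-+ p (- p) k)
      (D.trans (D.+-congˡ (coeff-- p k)) (D.-‿inverseʳ _))

    ·-cong : ∀ {a b p q} → a D.≈ b → p ≈ q → a · p ≈ b · q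
    ·-cong {a} {b} {p} {q} e f .at k = D.trans (coeff-· a p k)
      (D.trans (D.*-cong e (f .at k)) (D.sym (coeff-· b q k)))

    ·-zeroˡ : ∀ p → 0# · p ≈ []
    ·-zeroˡ p .at k = D.trans (coeff-· 0# p k) (D.zeroˡ _)

    ·-identityˡ : ∀ p → 1# · p ≈ p
    ·-identityˡ p .at k = D.trans (coeff-· 1# p k) (D.*-identityˡ _)

    ·-distribˡ : ∀ a p q → a · (p + q) ≈ a · p + a · q
    ·-distribˡ a p q .at k = begin
      coeff (a · (p + q)) k                   ≈⟨ coeff-· a (p + q) k ⟩
      a D.* coeff (p + q) k                   ≈⟨ D.*-congˡ (coeff-+ p q k) ⟩
      a D.* (coeff p k D.+ coeff q k)         ≈⟨ D.distribˡ _ _ _ ⟩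
      a D.* coeff p k D.+ a D.* coeff q k     ≈⟨ D.+-cong (coeff-· a p k) (coeff-· a q k) ⟨
      coeff (a · p) k D.+ coeff (a · q) k     ≈⟨ coeff-+ (a · p) (a · q) k ⟨
      coeff (a · p + a · q) k                 ∎
      where open SetoidReasoning D.setoid

    ·-distribʳ : ∀ p a b → (a D.+ b) · p ≈ a · p + b · p
    ·-distribʳ p a b .at k = begin
      coeff ((a D.+ b) · p) k                 ≈⟨ coeff-· (a D.+ b) p k ⟩
      (a D.+ b) D.* coeff p k                 ≈⟨ D.distribʳ _ _ _ ⟩
      a D.* coeff p k D.+ b D.* coeff p k     ≈⟨ D.+-cong (coeff-· a p k) (coeff-· b p k) ⟨
      coeff (a · p) k D.+ coeff (b · p) k     ≈⟨ coeff-+ (a · p) (b · p) k ⟨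
      coeff (a · p + b · p) k                 ∎
      where open SetoidReasoning D.setoid

    ·-assoc : ∀ a b p → (a D.* b) · p ≈ a · (b · p)
    ·-assoc a b p .at k = D.trans (coeff-· (a D.* b) p k) (D.trans (D.*-assoc _ _ _)
      (D.sym (D.trans (coeff-· a (b · p) k) (D.*-congˡ (coeff-· b p k)))))

    +-interchange : ∀ p q r s → (p + q) + (r + s) ≈ (p + r) + (q + s)
    +-interchange = CommutativeSemigroupProperties.interchange (record
      { Carrier = Poly ; _≈_ = _≈_ ; _∙_ = _+_
      ; isCommutativeSemigroup = record
        { isSemigroup = record
          { isMagma = record
            { isEquivalence = record { refl = refl ; sym = sym ; trans = trans }
            ; ∙-cong = +-cong }
          ; assoc = +-assoc }
        ; comm = +-comm } })

    *-congˡ : ∀ p {q r} → q ≈ r → p * q ≈ p * r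
    *-congˡ []      e = refl
    *-congˡ (a ∷ p) e = +-cong (·-cong D.refl e) (∷-cong D.refl (*-congˡ p e))

    *-zeroʳ : ∀ p → p * [] ≈ []
    *-zeroʳ []      = refl
    *-zeroʳ (a ∷ p) = 0∷≈0 D.refl (*-zeroʳ p)

    *-∷ : ∀ p b q → p * (b ∷ q) ≈ b · p + (0# ∷ p * q)
    *-∷ []      b q = sym (0∷≈0 D.refl refl)
    *-∷ (a ∷ p) b q = ∷-cong (D.+-congʳ (D.*-comm a b))
      (trans (+-cong refl (*-∷ p b q))
      (trans (sym (+-assoc (a · q) (b · p) _))
      (trans (+-cong (+-comm (a · q) (b · p)) refl)
             (+-assoc (b · p) (a · q) _))))

    *-comm : ∀ p q → p * q ≈ q * p
    *-comm []      q = sym (*-zeroʳ q)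
    *-comm (a ∷ p) q = trans (+-cong refl (∷-cong D.refl (*-comm p q))) (sym (*-∷ q a p))

    *-cong : ∀ {p p′ q q′} → p ≈ p′ → q ≈ q′ → p * q ≈ p′ * q′
    *-cong {p} {p′} {q} {q′} e f = trans (*-congˡ p f)
      (trans (*-comm p q′) (trans (*-congˡ q′ e) (*-comm q′ p′)))

    *-distribˡ : ∀ p q r → p * (q + r) ≈ p * q + p * r
    *-distribˡ []      q r = refl
    *-distribˡ (a ∷ p) q r =
      trans (+-cong (·-distribˡ a q r)
                    (∷-cong (D.sym (D.+-identityˡ _)) (*-distribˡ p q r)))
            (+-interchange (a · q) (a · r) (0# ∷ p * q) (0# ∷ p * r))

    *-distribʳ : ∀ p q r → (q + r) * p ≈ q * p + r * p
    *-distribʳ p q r = trans (*-comm (q + r) p) (trans (*-distribˡ p q r)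
      (+-cong (*-comm p q) (*-comm p r)))

    ·-*-assoc : ∀ a p q → (a · p) * q ≈ a · (p * q)
    ·-*-assoc a []      q = refl
    ·-*-assoc a (b ∷ p) q =
      trans (+-cong (·-assoc a b q) (∷-cong (D.sym (D.zeroʳ a)) (·-*-assoc a p q)))
            (sym (·-distribˡ a (b · q) (0# ∷ p * q)))

    *-assoc : ∀ p q r → (p * q) * r ≈ p * (q * r)
    *-assoc []      q r = refl
    *-assoc (a ∷ p) q r =
      trans (*-distribʳ r (a · q) (0# ∷ p * q))
            (+-cong (·-*-assoc a q r)
                    (trans (+-cong (·-zeroˡ r) refl) (∷-cong D.refl (*-assoc p q r))))

    *-identityˡ : ∀ p → (1# ∷ []) * p ≈ p
    *-identityˡ p = trans (+-cong (·-identityˡ p) (0∷≈0 D.refl refl)) (+-identityʳ p)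

    infix 4 _≈?_
    _≈?_ : Decidable _≈_
    []      ≈? []      = yes refl
    []      ≈? (b ∷ q) = Dec.map′
      (λ (e , f) → sym (0∷≈0 (D.sym e) (sym f)))
      (λ e → e .at zero , sym (tail-≈0 (sym e)))
      ((0# D.≈? b) ×-dec ([] ≈? q))
    (a ∷ p) ≈? []      = Dec.map′
      (λ (e , f) → 0∷≈0 e f)
      (λ e → e .at zero , tail-≈0 e)
      ((a D.≈? 0#) ×-dec (p ≈? []))
    (a ∷ p) ≈? (b ∷ q) = Dec.map′
      (λ (e , f) → ∷-cong e f)
      (λ e → e .at zero , coeffwise (λ k → e .at (suc k)))
      ((a D.≈? b) ×-dec (p ≈? q))

    *-nonZero-∷ : ∀ a p q → ¬ a D.≈ 0# → ¬ q ≈ [] → ¬ (a ∷ p) * q ≈ []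
    *-nonZero-∷ a p []      a≉0 q≉0 e = q≉0 refl
    *-nonZero-∷ a p (b ∷ q) a≉0 q≉0 e with b D.≈? 0#
    ... | yes b≈0 = *-nonZero-∷ a p q a≉0 (λ q≈0 → q≉0 (0∷≈0 b≈0 q≈0))
      (tail-≈0 (trans (sym (trans (*-∷ (a ∷ p) b q)
        (+-cong (trans (·-cong b≈0 refl) (·-zeroˡ (a ∷ p))) refl))) e))
    ... | no  b≉0 = D.*-nonZero a≉0 b≉0 (D.trans (D.sym (D.+-identityʳ _)) (e .at zero))

    *-nonZero : ∀ p q → ¬ p ≈ [] → ¬ q ≈ [] → ¬ p * q ≈ []
    *-nonZero []      q p≉0 q≉0 e = p≉0 refl
    *-nonZero (a ∷ p) q p≉0 q≉0 e with a D.≈? 0#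
    ... | yes a≈0 = *-nonZero p q (λ p≈0 → p≉0 (0∷≈0 a≈0 p≈0)) q≉0
      (tail-≈0 (trans (sym (+-cong (trans (·-cong a≈0 refl) (·-zeroˡ q)) refl)) e))
    ... | no  a≉0 = *-nonZero-∷ a p q a≉0 q≉0 e

  integralDomain : IntegralDomain c ℓ
  integralDomain = record
    { commutativeRing = record
      { Carrier = Poly
      ; _≈_ = _≈_
      ; _+_ = _+_
      ; _*_ = _*_
      ; -_ = -_
      ; 0# = []
      ; 1# = 1# ∷ []
      ; isCommutativeRing = record
        { isRing = record
          { +-isAbelianGroup = record
            { isGroup = record
              { isMonoid = record
                { isSemigroup = record
                  { isMagma = record
                    { isEquivalence = record { refl = refl ; sym = sym ; trans = trans }
                    ; ∙-cong = +-cong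
                    }
                  ; assoc = +-assoc
                  }
                ; identity = (λ _ → refl) , +-identityʳ
                }
              ; inverse = (λ p → trans (+-comm (- p) p) (-‿inverseʳ p)) , -‿inverseʳ
              ; ⁻¹-cong = -‿cong
              }
            ; comm = +-comm
            }
          ; *-cong = *-cong
          ; *-assoc = *-assoc
          ; *-identity = *-identityˡ , λ p → trans (*-comm p _) (*-identityˡ p)
          ; distrib = *-distribˡ , *-distribʳ
          }
        ; *-comm = *-comm
        }
      }
    ; _≈?_ = _≈?_
    ; 1≉0 = λ e → D.1≉0 (e .at zero)
    ; *-nonZero = λ {p} {q} → *-nonZero p q
    }

ℚ[X_] : ℕ → IntegralDomain 0ℓ 0ℓ
ℚ[X zero  ] = ℚ-integralDomain
ℚ[X suc N ] = Polynomial.integralDomain ℚ[X N ]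

X : ∀ {N} → Fin N → IntegralDomain.Carrier ℚ[X N ]
X {suc N} zero    = IntegralDomain.0# ℚ[X N ] ∷ IntegralDomain.1# ℚ[X N ] ∷ []
X {suc N} (suc i) = X i ∷ []

module Fractions {c ℓ} (D : IntegralDomain c ℓ) where
  private
    module D = IntegralDomain D
    open D using (0#; 1#; _≉_)
    open SemiringSolver D.commutativeSemiring using (solve; _:=_; _:+_; _:*_)
    open RingProperties D.ring using (-‿distribˡ-*)
    open SetoidReasoning D.setoid

  record Fraction : Set (c ⊔ ℓ) where
    constructor _/_[_]
    field
      num     : D.Carrier
      den     : D.Carrier
      den≉0   : den ≉ 0#
  open Fraction public

  infix 4 _≈_
  record _≈_ (x y : Fraction) : Set ℓ where
    constructor crossMultiply
    field cross≈ : num x D.* den y D.≈ num y D.* den x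
  open _≈_ public

  infixl 6 _+_
  infixl 7 _*_
  infix  8 -_ _⁻¹

  fromDomain : D.Carrier → Fraction
  fromDomain a = a / 1# [ D.1≉0 ]

  _+_ _*_ : Fraction → Fraction → Fraction
  (a / b [ b≉0 ]) + (c / d [ d≉0 ]) = (a D.* d D.+ c D.* b) / b D.* d [ D.*-nonZero b≉0 d≉0 ]
  (a / b [ b≉0 ]) * (c / d [ d≉0 ]) = (a D.* c) / b D.* d [ D.*-nonZero b≉0 d≉0 ]

  -_ : Fraction → Fraction
  - (a / b [ b≉0 ]) = (D.- a) / b [ b≉0 ]

  _⁻¹ : Fraction → Fraction
  (a / b [ b≉0 ]) ⁻¹ with a D.≈? 0#
  ... | yes _   = fromDomain 0#
  ... | no  a≉0 = b / a [ a≉0 ]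

  private
    cancel : ∀ {a b c} → c ≉ 0# → a D.* c D.≈ b D.* c → a D.≈ b
    cancel {a} {b} {c} c≉0 e with (a D.- b) D.≈? 0#
    ... | yes a-b≈0 = begin
      a                    ≈⟨ D.+-identityʳ a ⟨
      a D.+ 0#             ≈⟨ D.+-congˡ (D.-‿inverseˡ b) ⟨
      a D.+ (D.- b D.+ b)  ≈⟨ D.+-assoc _ _ _ ⟨
      a D.- b D.+ b        ≈⟨ D.+-congʳ a-b≈0 ⟩
      0# D.+ b             ≈⟨ D.+-identityˡ b ⟩
      b                    ∎
    ... | no  a-b≉0 = ⊥-elim (D.*-nonZero a-b≉0 c≉0 (begin
      (a D.- b) D.* c               ≈⟨ D.distribʳ _ _ _ ⟩
      a D.* c D.+ (D.- b) D.* c     ≈⟨ D.+-cong e (D.sym (-‿distribˡ-* b c)) ⟩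
      b D.* c D.+ D.- (b D.* c)     ≈⟨ D.-‿inverseʳ _ ⟩
      0#                            ∎))

    refl : ∀ {x} → x ≈ x
    refl .cross≈ = D.refl

    sym : ∀ {x y} → x ≈ y → y ≈ x
    sym e .cross≈ = D.sym (e .cross≈)

    trans : ∀ {x y z} → x ≈ y → y ≈ z → x ≈ z
    trans {a / b [ _ ]} {c / d [ d≉0 ]} {e / f [ _ ]} (crossMultiply p) (crossMultiply q) .cross≈ =
      cancel d≉0 (begin
        a D.* f D.* d   ≈⟨ solve 3 (λ a f d → a :* f :* d := a :* d :* f) D.refl a f d ⟩
        a D.* d D.* f   ≈⟨ D.*-congʳ p ⟩
        c D.* b D.* f   ≈⟨ solve 3 (λ c b f → c :* b :* f := c :* f :* b) D.refl c b f ⟩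
        c D.* f D.* b   ≈⟨ D.*-congʳ q ⟩
        e D.* d D.* b   ≈⟨ solve 3 (λ e d b → e :* d :* b := e :* b :* d) D.refl e d b ⟩
        e D.* b D.* d   ∎)

    +-cong : ∀ {x x′ y y′} → x ≈ x′ → y ≈ y′ → x + y ≈ x′ + y′
    +-cong {a / b [ _ ]} {a′ / b′ [ _ ]} {c / d [ _ ]} {c′ / d′ [ _ ]}
      (crossMultiply p) (crossMultiply q) .cross≈ = begin
        (a D.* d D.+ c D.* b) D.* (b′ D.* d′)
          ≈⟨ solve 6 (λ a b c d b′ d′ → (a :* d :+ c :* b) :* (b′ :* d′)
               := (a :* b′) :* (d :* d′) :+ (c :* d′) :* (b :* b′)) D.refl a b c d b′ d′ ⟩
        (a D.* b′) D.* (d D.* d′) D.+ (c D.* d′) D.* (b D.* b′)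
          ≈⟨ D.+-cong (D.*-congʳ p) (D.*-congʳ q) ⟩
        (a′ D.* b) D.* (d D.* d′) D.+ (c′ D.* d) D.* (b D.* b′)
          ≈⟨ solve 6 (λ a′ b c′ d b′ d′ → (a′ :* b) :* (d :* d′) :+ (c′ :* d) :* (b :* b′)
               := (a′ :* d′ :+ c′ :* b′) :* (b :* d)) D.refl a′ b c′ d b′ d′ ⟩
        (a′ D.* d′ D.+ c′ D.* b′) D.* (b D.* d) ∎

    *-cong : ∀ {x x′ y y′} → x ≈ x′ → y ≈ y′ → x * y ≈ x′ * y′
    *-cong {a / b [ _ ]} {a′ / b′ [ _ ]} {c / d [ _ ]} {c′ / d′ [ _ ]}
      (crossMultiply p) (crossMultiply q) .cross≈ = begin
        (a D.* c) D.* (b′ D.* d′)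
          ≈⟨ solve 4 (λ a c b′ d′ → (a :* c) :* (b′ :* d′) := (a :* b′) :* (c :* d′)) D.refl a c b′ d′ ⟩
        (a D.* b′) D.* (c D.* d′)   ≈⟨ D.*-cong p q ⟩
        (a′ D.* b) D.* (c′ D.* d)
          ≈⟨ solve 4 (λ a′ b c′ d → (a′ :* b) :* (c′ :* d) := (a′ :* c′) :* (b :* d)) D.refl a′ b c′ d ⟩
        (a′ D.* c′) D.* (b D.* d)   ∎

    -‿cong : ∀ {x y} → x ≈ y → - x ≈ - y
    -‿cong {a / b [ _ ]} {c / d [ _ ]} (crossMultiply p) .cross≈ =
      D.trans (D.sym (-‿distribˡ-* a d)) (D.trans (D.-‿cong p) (-‿distribˡ-* c b))

    +-assoc : ∀ x y z → (x + y) + z ≈ x + (y + z)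
    +-assoc (a / b [ _ ]) (c / d [ _ ]) (e / f [ _ ]) .cross≈ =
      solve 6 (λ a b c d e f →
        ((a :* d :+ c :* b) :* f :+ e :* (b :* d)) :* (b :* (d :* f))
        := (a :* (d :* f) :+ (c :* f :+ e :* d) :* b) :* ((b :* d) :* f)) D.refl a b c d e f

    +-comm : ∀ x y → x + y ≈ y + x
    +-comm (a / b [ _ ]) (c / d [ _ ]) .cross≈ =
      solve 4 (λ a b c d → (a :* d :+ c :* b) :* (d :* b) := (c :* b :+ a :* d) :* (b :* d))
        D.refl a b c d

    +-identityʳ : ∀ x → x + fromDomain 0# ≈ x
    +-identityʳ (a / b [ _ ]) .cross≈ = begin
      (a D.* 1# D.+ 0# D.* b) D.* b
        ≈⟨ D.*-congʳ (D.+-cong (D.*-identityʳ a) (D.zeroˡ b)) ⟩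
      (a D.+ 0#) D.* b    ≈⟨ D.*-cong (D.+-identityʳ a) (D.sym (D.*-identityʳ b)) ⟩
      a D.* (b D.* 1#)    ∎

    -‿inverseʳ : ∀ x → x + - x ≈ fromDomain 0#
    -‿inverseʳ (a / b [ _ ]) .cross≈ = begin
      (a D.* b D.+ (D.- a) D.* b) D.* 1#   ≈⟨ D.*-identityʳ _ ⟩
      a D.* b D.+ (D.- a) D.* b            ≈⟨ D.distribʳ _ _ _ ⟨
      (a D.- a) D.* b                      ≈⟨ D.*-congʳ (D.-‿inverseʳ a) ⟩
      0# D.* b                             ≈⟨ D.zeroˡ b ⟩
      0#                                   ≈⟨ D.zeroˡ _ ⟨
      0# D.* (b D.* b)                     ∎

    *-assoc : ∀ x y z → (x * y) * z ≈ x * (y * z)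
    *-assoc (a / b [ _ ]) (c / d [ _ ]) (e / f [ _ ]) .cross≈ =
      solve 6 (λ a b c d e f → ((a :* c) :* e) :* (b :* (d :* f))
        := (a :* (c :* e)) :* ((b :* d) :* f)) D.refl a b c d e f

    *-comm : ∀ x y → x * y ≈ y * x
    *-comm (a / b [ _ ]) (c / d [ _ ]) .cross≈ =
      solve 4 (λ a b c d → (a :* c) :* (d :* b) := (c :* a) :* (b :* d)) D.refl a b c d

    *-identityˡ : ∀ x → fromDomain 1# * x ≈ x
    *-identityˡ (a / b [ _ ]) .cross≈ = begin
      (1# D.* a) D.* b    ≈⟨ D.*-congʳ (D.*-comm 1# a) ⟩
      (a D.* 1#) D.* b    ≈⟨ D.*-assoc _ _ _ ⟩
      a D.* (1# D.* b)    ∎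

    *-distribˡ : ∀ x y z → x * (y + z) ≈ x * y + x * z
    *-distribˡ (a / b [ _ ]) (c / d [ _ ]) (e / f [ _ ]) .cross≈ =
      solve 6 (λ a b c d e f →
        (a :* (c :* f :+ e :* d)) :* ((b :* d) :* (b :* f))
        := ((a :* c) :* (b :* f) :+ (a :* e) :* (b :* d)) :* (b :* (d :* f))) D.refl a b c d e f

    num≈0 : ∀ {x} → x ≈ fromDomain 0# → num x D.≈ 0#
    num≈0 e = D.trans (D.sym (D.*-identityʳ _)) (D.trans (e .cross≈) (D.zeroˡ _))

    ≈0 : ∀ {x} → num x D.≈ 0# → x ≈ fromDomain 0#
    ≈0 e .cross≈ = D.trans (D.*-congʳ e) (D.trans (D.zeroˡ _) (D.sym (D.zeroˡ _)))

    ⁻¹-cong : ∀ {x y} → x ≈ y → x ⁻¹ ≈ y ⁻¹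
    ⁻¹-cong {a / b [ _ ]} {c / d [ _ ]} e with a D.≈? 0# | c D.≈? 0#
    ... | yes _   | yes _   = refl
    ... | yes a≈0 | no  c≉0 = ⊥-elim (c≉0 (num≈0 (trans (sym e) (≈0 a≈0))))
    ... | no  a≉0 | yes c≈0 = ⊥-elim (a≉0 (num≈0 (trans e (≈0 c≈0))))
    ... | no  a≉0 | no  c≉0 = crossMultiply
      (D.trans (D.*-comm b c) (D.trans (D.sym (e .cross≈)) (D.*-comm a d)))

    ⁻¹-inverseʳ : ∀ {x} → ¬ x ≈ fromDomain 0# → x * x ⁻¹ ≈ fromDomain 1#
    ⁻¹-inverseʳ {a / b [ _ ]} x≉0 with a D.≈? 0#
    ... | yes a≈0 = ⊥-elim (x≉0 (≈0 a≈0))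
    ... | no  a≉0 = crossMultiply (D.trans (D.*-identityʳ _)
                      (D.trans (D.*-comm a b) (D.sym (D.*-identityˡ _))))

    0⁻¹≈0 : fromDomain 0# ⁻¹ ≈ fromDomain 0#
    0⁻¹≈0 with 0# D.≈? 0#
    ... | yes _   = refl
    ... | no  0≉0 = ⊥-elim (0≉0 D.refl)

  fractionField : Field (c ⊔ ℓ) ℓ
  fractionField = record
    { commutativeRing = record
      { Carrier = Fraction
      ; _≈_ = _≈_
      ; _+_ = _+_
      ; _*_ = _*_
      ; -_ = -_
      ; 0# = fromDomain 0#
      ; 1# = fromDomain 1#
      ; isCommutativeRing = record
        { isRing = record
          { +-isAbelianGroup = record
            { isGroup = record
              { isMonoid = record
                { isSemigroup = record
                  { isMagma = record
                    { isEquivalence = record { refl = refl ; sym = sym ; trans = trans }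
                    ; ∙-cong = +-cong
                    }
                  ; assoc = +-assoc
                  }
                ; identity = (λ x → trans (+-comm (fromDomain 0#) x) (+-identityʳ x)) , +-identityʳ
                }
              ; inverse = (λ x → trans (+-comm (- x) x) (-‿inverseʳ x)) , -‿inverseʳ
              ; ⁻¹-cong = -‿cong
              }
            ; comm = +-comm
            }
          ; *-cong = *-cong
          ; *-assoc = *-assoc
          ; *-identity = *-identityˡ , λ x → trans (*-comm x (fromDomain 1#)) (*-identityˡ x)
          ; distrib = *-distribˡ
                    , λ x y z → trans (*-comm (y + z) x) (trans (*-distribˡ x y z)
                        (+-cong (*-comm x y) (*-comm x z)))
          }
        ; *-comm = *-comm
        }
      }
    ; 1≉0 = λ e → D.1≉0 (num≈0 e)
    ; _⁻¹ = _⁻¹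
    ; ⁻¹-cong = ⁻¹-cong
    ; ⁻¹-inverseʳ = ⁻¹-inverseʳ
    ; 0⁻¹≈0 = 0⁻¹≈0
    }

module Pfaffian {c ℓ} (F : Field c ℓ) where
  open Field F hiding (zero)

  Matrix : ℕ → Set c
  Matrix m = Fin m → Fin m → Carrier

  delete : ∀ {m} → Fin (suc m) → Matrix (suc m) → Matrix m
  delete i A r s = A (punchIn i r) (punchIn i s)

  -- Several indices are deleted in decreasing order, so that each deletion
  -- leaves the positions of the smaller indices unchanged.
  -- When Pf (A^(1,2,2n-1,2n)) = 0 the value is the junk value 0; for a generic
  -- matrix this does not occur.
  Pf : Carrier → ∀ n → Matrix (n ℕ.* 2) → Carrier
  Pf λ′ zero          A = 1#
  Pf λ′ (suc zero)    A = A zero (suc zero)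
  Pf λ′ (suc (suc k)) A =
    ( Pf λ′ (suc k) (delete 1st (delete 2nd A)) * Pf λ′ (suc k) (delete pen′ (delete last A))
    - λ′ * Pf λ′ (suc k) (delete 1st (delete pen A)) * Pf λ′ (suc k) (delete 2nd (delete last A))
    + λ′ * Pf λ′ (suc k) (delete 1st (delete last A)) * Pf λ′ (suc k) (delete 2nd (delete pen A))
    ) / Pf λ′ k (delete 1st (delete 2nd (delete pen′ (delete last A))))
    where
    1st : ∀ {m} → Fin (suc m)
    1st = zero

    2nd : ∀ {m} → Fin (suc (suc m))
    2nd = suc zero

    last pen : Fin (4 ℕ.+ k ℕ.* 2)
    last = fromℕ (3 ℕ.+ k ℕ.* 2)
    pen  = inject₁ (fromℕ (2 ℕ.+ k ℕ.* 2))

    -- pen, as a position in the matrix from which last has been deleted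
    pen′ : Fin (3 ℕ.+ k ℕ.* 2)
    pen′ = fromℕ (2 ℕ.+ k ℕ.* 2)

-- The pairs i < j in Fin m are numbered row by row.
#pairs : ℕ → ℕ
#pairs zero    = 0
#pairs (suc m) = m ℕ.+ #pairs m

pairIndex : ∀ {m} (i j : Fin m) → i < j → Fin (#pairs m)
pairIndex {suc m} zero    (suc j) _         = j ↑ˡ #pairs m
pairIndex {suc m} (suc i) (suc j) (s≤s i<j) = m ↑ʳ pairIndex i j i<j

-- Variable 0 is λ; the others are the entries above the diagonal.
module Generic (m : ℕ) where
  private
    D : IntegralDomain 0ℓ 0ℓ
    D = ℚ[X suc (#pairs m) ]

  RationalFunctions : Field 0ℓ 0ℓ
  RationalFunctions = Fractions.fractionField D

  open Field RationalFunctions hiding (zero)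
  open Fractions D using (fromDomain)

  var : Fin (suc (#pairs m)) → Carrier
  var i = fromDomain (X i)

  λ′ : Carrier
  λ′ = var zero

  A : Fin m → Fin m → Carrier
  A i j with <-cmp i j
  ... | tri< i<j _ _ = var (suc (pairIndex i j i<j))
  ... | tri≈ _ _ _   = 0#
  ... | tri> _ _ j<i = - var (suc (pairIndex j i j<i))

-- A sequence ((m₁,m₂),…,(m₂ₙ₋₁,m₂ₙ)) of pairs of elements of [2n]
Pairs : ℕ → Set
Pairs n = Vec (Fin (n ℕ.* 2) × Fin (n ℕ.* 2)) n

IsPerfectMatching : ∀ {n} → Pairs n → Set
IsPerfectMatching m =
    All (λ (a , b) → a < b) m
  × Linked (λ (a , _) (c , _) → a < c) m
  × (∀ i → Any (λ (a , b) → i ≡.≡ a ⊎ i ≡.≡ b) m)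

isPerfectMatching? : ∀ {n} → Unary.Decidable (IsPerfectMatching {n})
isPerfectMatching? m =
    All.all? (λ (a , b) → a <? b) m
  ×-dec Linked.linked? (λ (a , _) (c , _) → a <? c) m
  ×-dec all? (λ i → Any.any? (λ (a , b) → (i ≟ a) ⊎-dec (i ≟ b)) m)

allVecs : ∀ {A : Set} → List A → ∀ n → List (Vec A n)
allVecs xs zero    = [] ∷ []
allVecs xs (suc n) = cartesianProductWith _∷_ xs (allVecs xs n)

perfectMatchings : ∀ n → List (Pairs n)
perfectMatchings n =
  filter isPerfectMatching?
    (allVecs (cartesianProduct (allFin (n ℕ.* 2)) (allFin (n ℕ.* 2))) n)

-- allPairs m m lists the ordered pairs of entries of m; since a < c is
-- required, an unordered pair is counted at most once.
cross nest : ∀ {n} → Pairs n → ℕ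
cross m = count (λ ((a , b) , (c , d)) → (a <? c) ×-dec (c <? b) ×-dec (b <? d)) (allPairs m m)
nest  m = count (λ ((a , b) , (c , d)) → (a <? c) ×-dec (c <? d) ×-dec (d <? b)) (allPairs m m)

{-# OPTIONS --safe #-}
module Submission where

open import Defs
open import Algebra.Bundles using (CommutativeRing)
open import Algebra.Morphism.Structures using (IsRingHomomorphism)
import Algebra.Properties.CommutativeSemigroup as CommutativeSemigroupProperties
import Algebra.Properties.Ring as RingProperties
import Algebra.Properties.Semiring.Exp as Exponentiation
open import Data.Bool.Base using (if_then_else_; true; false)
open import Data.Empty using (⊥-elim)
open import Data.Fin.Base using (Fin; zero; suc; _<_; toℕ; fromℕ; inject₁; punchIn)
open import Data.Fin.Properties as Fin using (_≟_; _<?_; <-cmp)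
open import Data.List.Base as List
  using (List; []; _∷_; _++_; map; foldr; concatMap; length; allFin; tabulate)
open import Data.List.Membership.Propositional using (_∈_; find)
open import Data.List.Membership.Propositional.Properties
  using (∈-∃++; ∈-++⁺ˡ; ∈-map⁺; ∈-map⁻; ∈-concatMap⁺; ∈-concatMap⁻; ∈-cartesianProduct⁺;
         ∈-cartesianProductWith⁺; ∈-allFin; ∈-filter⁺; ∈-filter⁻)
open import Data.List.Membership.Propositional.Properties.WithK using (unique∧set⇒bag)
open import Data.List.Properties
  using (length-tabulate; map-∘; map-tabulate; tabulate-cong; ++-assoc; ++-identityʳ; ∷-injectiveʳ)
open import Data.List.Relation.Binary.BagAndSetEquality using (∼bag⇒↭)
open import Data.List.Relation.Binary.Permutation.Propositional as Perm
  using (_↭_; ↭⇒↭ₛ; ↭-refl; ↭-sym; ↭-trans; ↭-prep; ↭-swap)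
open import Data.List.Relation.Binary.Permutation.Propositional.Properties
  using (↭-empty-inv; ∈-resp-↭; All-resp-↭; drop-∷; shift; ↭-length; map⁺)
open import Data.List.Relation.Binary.Permutation.Setoid.Properties using (Unique-resp-↭)
open import Data.List.Relation.Unary.All as All using (All; []; _∷_)
import Data.List.Relation.Unary.All.Properties as All
open import Data.List.Relation.Unary.AllPairs as AllPairs using (AllPairs; []; _∷_)
import Data.List.Relation.Unary.AllPairs.Properties as AllPairs
open import Data.List.Relation.Unary.Any as Any using (here; there)
open import Data.List.Relation.Unary.Unique.Propositional using (Unique)
import Data.List.Relation.Unary.Unique.Propositional.Properties as Unique
open import Data.Nat.Base as ℕ using (ℕ; zero; suc)
import Data.Nat.ListAction as ℕ
import Data.Nat.ListAction.Properties as ℕ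
import Data.Nat.Properties as ℕ
open import Data.Nat.Solver using (module +-*-Solver)
open import Data.Product.Base using (∃; _×_; _,_; proj₁; proj₂)
open import Data.Sum.Base using (_⊎_; inj₁; inj₂)
open import Data.Vec.Base as Vec using (Vec; []; _∷_; allPairs; count; toList)
open import Data.Vec.Properties using (∷-injective)
open import Data.Vec.Relation.Unary.All as VecAll using ([]; _∷_)
open import Data.Vec.Relation.Unary.Any as VecAny using (here; there)
open import Data.Vec.Relation.Unary.Linked as Linked using (Linked; []; [-]; _∷_)
open import Function.Base using (_∘_; id)
open import Function.Bundles using (mk⇔)
open import Relation.Binary.Definitions using (tri<; tri≈; tri>)
open import Relation.Binary.PropositionalEquality as ≡ using (_≡_; _≢_)
import Relation.Binary.Reasoning.Setoid as SetoidReasoning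
open import Relation.Nullary using (¬_; Dec; yes; no; does; _×-dec_)
open import Relation.Nullary.Decidable using (dec-true; dec-false)
open import Relation.Unary using (Decidable)

-- Label the positions 0, …, 2n-1.  The closing endpoints of a perfect matching m sum to
-- n² + cross(m) + nest(m): counting the endpoints to the left of each closer, every arc contributes
-- 1 and every pair of arcs contributes 2, plus 1 if it crosses or nests.  Hence λ^(n²) times the
-- matching sum of B is the ordinary Pfaffian of the skew matrix with entries λ^j B_ij above the
-- diagonal, and the condensation recurrence is, up to a common power of λ, the classical identity
--   Pf(Z) Pf(xyZpq) = Pf(Zpq) Pf(xyZ) - Pf(yZq) Pf(xZp) + Pf(yZp) Pf(xZq),
-- obtained by computing Σ ± Pf(I∖i) a_ij Pf(J∖j) for I = xZ and J = yZpq in two ways.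
-- The denominators do not vanish: setting λ = 0 in the recurrence leaves a product of two smaller
-- matching sums, so inductively the constant term in λ of a matching sum is nonzero.

-- Two obstacles shape the argument. `Pf` lives in a fraction field, where λ cannot be set to 0, and
-- a minor of a generic matrix is not the generic matrix of the smaller size. The matching sum is
-- therefore studied for arbitrary matrices `B` over a domain `D` that maps both to the field (`ι`)
-- and to a domain `E` in which λ becomes 0 (`φ`). Genericity is used only as `Regular`: `φ` sends
-- no entry above the diagonal to 0. This passes to every minor along a strictly monotone `σ`. The
-- factor λ in the recurrence comes from minors keeping the weights of their original columns. When
-- the penultimate column is deleted but the last is kept, the weight of the last column exceeds its
-- relabelled position by one more than those of the other closers do. This happens once in each
-- mixed product and never in the others.

module RingLemmas {c ℓ} (R : CommutativeRing c ℓ) where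
  open CommutativeRing R hiding (zero)
  open RingProperties ring
  open SetoidReasoning setoid

  0≈-0 : 0# ≈ - 0#
  0≈-0 = sym -0#≈0#

  -‿cong₂ : ∀ {w x y z} → w ≈ x → y ≈ z → w - y ≈ x - z
  -‿cong₂ e f = +-cong e (-‿cong f)

  x-0≈x : ∀ {x y} → y ≈ 0# → x - y ≈ x
  x-0≈x {x} {y} e = begin
    x - y    ≈⟨ -‿cong₂ refl e ⟩
    x - 0#   ≈⟨ +-congˡ 0≈-0 ⟨
    x + 0#   ≈⟨ +-identityʳ x ⟩
    x        ∎

  nested-differences : ∀ u v w → u - (v - w) ≈ (u - v) + w
  nested-differences u v w = begin
    u - (v - w)         ≈⟨ +-congˡ (⁻¹-anti-homo‿- v w) ⟩
    u + (w - v)         ≈⟨ +-congˡ (+-comm w (- v)) ⟩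
    u + (- v + w)       ≈⟨ +-assoc u (- v) w ⟨
    (u - v) + w         ∎

-- Signed contractions and alternating functions on words.

module Contraction {c ℓ} (R : CommutativeRing c ℓ) (I : Set) where
  open CommutativeRing R hiding (zero)
  open RingProperties ring
  open CommutativeSemigroupProperties +-commutativeSemigroup using (interchange)
  open RingLemmas R
  open SetoidReasoning setoid

  -- ∂ g f (l₀ ∷ … ∷ lᵣ) = Σₖ (-1)ᵏ g(lₖ) f(l₀ … l̂ₖ … lᵣ)
  ∂ : (I → Carrier) → (List I → Carrier) → List I → Carrier
  ∂ g f []      = 0#
  ∂ g f (y ∷ L) = g y * f L - ∂ g (f ∘ (y ∷_)) L

  ∂-cong : ∀ {g g′ f f′} → (∀ i → g i ≈ g′ i) → (∀ L → f L ≈ f′ L) → ∀ L → ∂ g f L ≈ ∂ g′ f′ L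
  ∂-cong e h []      = refl
  ∂-cong e h (y ∷ L) = -‿cong₂ (*-cong (e y) (h L)) (∂-cong e (h ∘ (y ∷_)) L)

  ∂-congˡ : ∀ g {f f′} → (∀ L → f L ≈ f′ L) → ∀ L → ∂ g f L ≈ ∂ g f′ L
  ∂-congˡ g = ∂-cong (λ _ → refl)

  -- The integrand is the shape of a contraction unfolded at a fixed leading letter, with `u` the
  -- coefficient of that letter. `∂∂` uses it in this form.
  ∂-linearʳ : ∀ g u f h L → ∂ g (λ K → u * f K - h K) L ≈ u * ∂ g f L - ∂ g h L
  ∂-linearʳ g u f h []      = sym (trans (-‿cong₂ (zeroʳ u) refl) (-‿inverseʳ 0#))
  ∂-linearʳ g u f h (y ∷ L) = begin
    g y * (u * f L - h L) - ∂ g (λ K → u * f (y ∷ K) - h (y ∷ K)) L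
      ≈⟨ -‿cong₂ (trans (x[y-z]≈xy-xz _ _ _) (-‿cong₂ (trans (sym (*-assoc _ _ _))
           (trans (*-congʳ (*-comm _ _)) (*-assoc _ _ _))) refl)) (∂-linearʳ g u _ _ L) ⟩
    (u * (g y * f L) - g y * h L) - (u * ∂ g (f ∘ (y ∷_)) L - ∂ g (h ∘ (y ∷_)) L)
      ≈⟨ +-congˡ (sym (-‿+-comm _ _)) ⟩
    (u * (g y * f L) - g y * h L) + (- (u * ∂ g (f ∘ (y ∷_)) L) - - ∂ g (h ∘ (y ∷_)) L)
      ≈⟨ interchange _ _ _ _ ⟩
    (u * (g y * f L) - u * ∂ g (f ∘ (y ∷_)) L) + (- (g y * h L) - - ∂ g (h ∘ (y ∷_)) L)
      ≈⟨ +-cong (x[y-z]≈xy-xz _ _ _) (sym (-‿+-comm _ _)) ⟨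
    u * (g y * f L - ∂ g (f ∘ (y ∷_)) L) - (g y * h L - ∂ g (h ∘ (y ∷_)) L) ∎

  -- The counterpart for the coefficient function: as a function of `i`, `∂ (a i) f (y ∷ K)` unfolds
  -- to `a i y * f K` minus a shorter contraction.
  ∂-linearˡ : ∀ u v r f L → ∂ (λ i → u i * r - v i) f L ≈ ∂ u f L * r - ∂ v f L
  ∂-linearˡ u v r f []      = sym (trans (-‿cong₂ (zeroˡ r) refl) (-‿inverseʳ 0#))
  ∂-linearˡ u v r f (y ∷ L) = begin
    (u y * r - v y) * f L - ∂ (λ i → u i * r - v i) (f ∘ (y ∷_)) L
      ≈⟨ -‿cong₂ (trans ([y-z]x≈yx-zx _ _ _) (-‿cong₂ (trans (*-assoc _ _ _)
           (trans (*-congˡ (*-comm _ _)) (sym (*-assoc _ _ _)))) refl)) (∂-linearˡ u v r _ L) ⟩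
    (u y * f L * r - v y * f L) - (∂ u (f ∘ (y ∷_)) L * r - ∂ v (f ∘ (y ∷_)) L)
      ≈⟨ +-congˡ (sym (-‿+-comm _ _)) ⟩
    (u y * f L * r - v y * f L) + (- (∂ u (f ∘ (y ∷_)) L * r) - - ∂ v (f ∘ (y ∷_)) L)
      ≈⟨ interchange _ _ _ _ ⟩
    (u y * f L * r - ∂ u (f ∘ (y ∷_)) L * r) + (- (v y * f L) - - ∂ v (f ∘ (y ∷_)) L)
      ≈⟨ +-cong ([y-z]x≈yx-zx _ _ _) (sym (-‿+-comm _ _)) ⟨
    (u y * f L - ∂ u (f ∘ (y ∷_)) L) * r - (v y * f L - ∂ v (f ∘ (y ∷_)) L) ∎

  ∂-zeroʳ : ∀ g {f} → (∀ L → f L ≈ 0#) → ∀ L → ∂ g f L ≈ 0#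
  ∂-zeroʳ g e []      = refl
  ∂-zeroʳ g e (y ∷ L) = trans (x-0≈x (∂-zeroʳ g (e ∘ (y ∷_)) L)) (trans (*-congˡ (e L)) (zeroʳ _))

  ∂-zeroˡ : ∀ {g} → (∀ i → g i ≈ 0#) → ∀ f L → ∂ g f L ≈ 0#
  ∂-zeroˡ e f []      = refl
  ∂-zeroˡ e f (y ∷ L) = trans (x-0≈x (∂-zeroˡ e _ L)) (trans (*-congʳ (e y)) (zeroˡ _))

  ∂-neg : ∀ g f L → ∂ (λ i → - g i) f L ≈ - ∂ g f L
  ∂-neg g f []      = 0≈-0
  ∂-neg g f (y ∷ L) = trans (-‿cong₂ (sym (-‿distribˡ-* _ _)) (∂-neg g _ L)) ((-‿+-comm _ _))

  -- Interchange of a finite double sum: both sides remove one letter from `J` and one from `K`,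
  -- with the same signs. Each step of the induction on `K` splits off one column of the sum by
  -- `∂-linearˡ`.
  ∂-exchange : ∀ (a : I → I → Carrier) f h J K →
    ∂ (λ i → ∂ (a i) f K) h J ≈ ∂ (λ k → ∂ (λ i → a i k) h J) f K
  ∂-exchange a f h J []      = ∂-zeroˡ (λ _ → refl) h J
  ∂-exchange a f h J (y ∷ K) = trans (∂-linearˡ (λ i → a i y) _ (f K) h J)
    (+-congˡ (-‿cong (∂-exchange a (f ∘ (y ∷_)) h J K)))

  ∂∂ : ∀ g h f y L → ∂ g (∂ h f) (y ∷ L)
     ≈ (g y * ∂ h f L - h y * ∂ g f L) + ∂ g (∂ h (f ∘ (y ∷_))) L
  ∂∂ g h f y L = trans (+-congˡ (-‿cong (∂-linearʳ g (h y) f _ L))) (nested-differences _ _ _)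

  -- Removing two letters in the other order shifts the position of exactly one of them by one. In
  -- `∂∂` the terms that remove the leading letter are antisymmetric in `g` and `h`; the rest is a
  -- shorter instance.
  ∂-anticomm : ∀ g h f L → ∂ g (∂ h f) L ≈ - ∂ h (∂ g f) L
  ∂-anticomm g h f []      = 0≈-0
  ∂-anticomm g h f (y ∷ L) = begin
    ∂ g (∂ h f) (y ∷ L)
      ≈⟨ ∂∂ g h f y L ⟩
    (g y * ∂ h f L - h y * ∂ g f L) + ∂ g (∂ h (f ∘ (y ∷_))) L
      ≈⟨ +-cong (sym (⁻¹-anti-homo‿- _ _)) (∂-anticomm g h _ L) ⟩
    - (h y * ∂ g f L - g y * ∂ h f L) - ∂ h (∂ g (f ∘ (y ∷_))) L
      ≈⟨ -‿+-comm _ _ ⟩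
    - ((h y * ∂ g f L - g y * ∂ h f L) + ∂ h (∂ g (f ∘ (y ∷_))) L)
      ≈⟨ -‿cong (∂∂ h g f y L) ⟨
    - ∂ h (∂ g f) (y ∷ L) ∎

  ∂²≈0 : ∀ g f L → ∂ g (∂ g f) L ≈ 0#
  ∂²≈0 g f []      = refl
  ∂²≈0 g f (y ∷ L) = trans (∂∂ g g f y L)
    (trans (+-cong (-‿inverseʳ _) (∂²≈0 g _ L)) (+-identityʳ 0#))

  -- Vanishing on adjacent equal letters is a separate field because antisymmetry only makes twice
  -- the value zero, and 2 may be a zero divisor. `∂²≈0` stands beside `∂-anticomm` for the same
  -- reason.
  record Alternating (f : List I → Carrier) : Set ℓ where
    field
      transpose : ∀ P x y L → f (P ++ x ∷ y ∷ L) ≈ - f (P ++ y ∷ x ∷ L)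
      repeated  : ∀ P x L → f (P ++ x ∷ x ∷ L) ≈ 0#
  open Alternating

  alternating-∷ : ∀ {f} q → Alternating f → Alternating (f ∘ (q ∷_))
  alternating-∷ q alt .transpose P = alt .transpose (q ∷ P)
  alternating-∷ q alt .repeated  P = alt .repeated  (q ∷ P)

  -- For the two leading letters: the terms that delete one of them are exchanged with opposite
  -- signs, and all other terms keep both letters and inherit the property from `f`.
  alternating-∂ : ∀ g f → Alternating f → Alternating (∂ g f)
  alternating-∂ g f alt .transpose [] x y L = begin
    g x * f (y ∷ L) - (g y * f (x ∷ L) - ∂ g (f ∘ (x ∷_) ∘ (y ∷_)) L)
      ≈⟨ nested-differences _ _ _ ⟩
    (g x * f (y ∷ L) - g y * f (x ∷ L)) + ∂ g (f ∘ (x ∷_) ∘ (y ∷_)) L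
      ≈⟨ +-cong (sym (⁻¹-anti-homo‿- _ _))
           (∂-exchange-sign L) ⟩
    - (g y * f (x ∷ L) - g x * f (y ∷ L)) - ∂ g (f ∘ (y ∷_) ∘ (x ∷_)) L
      ≈⟨ -‿+-comm _ _ ⟩
    - ((g y * f (x ∷ L) - g x * f (y ∷ L)) + ∂ g (f ∘ (y ∷_) ∘ (x ∷_)) L)
      ≈⟨ -‿cong (nested-differences _ _ _) ⟨
    - (g y * f (x ∷ L) - (g x * f (y ∷ L) - ∂ g (f ∘ (y ∷_) ∘ (x ∷_)) L)) ∎
    where
    ∂-negʳ : ∀ h L → ∂ g (λ K → - h K) L ≈ - ∂ g h L
    ∂-negʳ h []      = 0≈-0
    ∂-negʳ h (z ∷ L) = trans (-‿cong₂ (sym (-‿distribʳ-* _ _)) (∂-negʳ _ L)) ((-‿+-comm _ _))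

    ∂-exchange-sign : ∀ L → ∂ g (f ∘ (x ∷_) ∘ (y ∷_)) L ≈ - ∂ g (f ∘ (y ∷_) ∘ (x ∷_)) L
    ∂-exchange-sign L = trans (∂-congˡ g (alt .transpose [] x y) L) (∂-negʳ _ L)
  alternating-∂ g f alt .transpose (q ∷ P) x y L = trans
    (-‿cong₂ (trans (*-congˡ (alt .transpose P x y L)) (sym (-‿distribʳ-* _ _)))
             (alternating-∂ g _ (alternating-∷ q alt) .transpose P x y L))
    ((-‿+-comm _ _))
  alternating-∂ g f alt .repeated [] x L = trans (nested-differences _ _ _)
    (trans (+-cong (-‿inverseʳ _) (∂-zeroʳ g (alt .repeated [] x) L)) (+-identityʳ 0#))
  alternating-∂ g f alt .repeated (q ∷ P) x L =
    trans (x-0≈x (alternating-∂ g _ (alternating-∷ q alt) .repeated P x L))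
          (trans (*-congˡ (alt .repeated P x L)) (zeroʳ _))

  sign : List I → Carrier
  sign []      = 1#
  sign (_ ∷ L) = - sign L

  insert-first : ∀ {f} → Alternating f → ∀ p K L → f (p ∷ K ++ L) ≈ sign K * f (K ++ p ∷ L)
  insert-first alt p []      L = sym (*-identityˡ _)
  insert-first {f} alt p (y ∷ K) L = begin
    f (p ∷ y ∷ K ++ L)                ≈⟨ alt .transpose [] p y (K ++ L) ⟩
    - f (y ∷ p ∷ K ++ L)              ≈⟨ -‿cong (insert-first (alternating-∷ y alt) p K L) ⟩
    - (sign K * f (y ∷ K ++ p ∷ L))   ≈⟨ -‿distribˡ-* _ _ ⟩
    - sign K * f (y ∷ K ++ p ∷ L)     ∎

  alternating-∈ : ∀ {f} → Alternating f → ∀ {z L} → z ∈ L → f (z ∷ L) ≈ 0#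
  alternating-∈ alt {z} z∈L with K , L , ≡.refl ← ∈-∃++ z∈L =
    trans (insert-first alt z K (z ∷ L)) (trans (*-congˡ (alt .repeated K z L)) (zeroʳ _))

  -- The letters of `K` contribute nothing but still advance the position, whence the factor
  -- `sign K`.
  ∂-skip : ∀ g f K L → (∀ {z} → z ∈ K → g z ≈ 0#) → ∂ g f (K ++ L) ≈ sign K * ∂ g (f ∘ (K ++_)) L
  ∂-skip g f []      L e = sym (*-identityˡ _)
  ∂-skip g f (y ∷ K) L e = begin
    g y * f (K ++ L) - ∂ g (f ∘ (y ∷_)) (K ++ L)
      ≈⟨ -‿cong₂ (trans (*-congʳ (e (here ≡.refl))) (zeroˡ _)) (∂-skip g _ K L (e ∘ there)) ⟩
    0# - sign K * ∂ g (f ∘ ((y ∷ K) ++_)) L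
      ≈⟨ +-identityˡ _ ⟩
    - (sign K * ∂ g (f ∘ ((y ∷ K) ++_)) L)
      ≈⟨ -‿distribˡ-* _ _ ⟩
    - sign K * ∂ g (f ∘ ((y ∷ K) ++_)) L ∎
    where open import Data.List.Relation.Unary.Any using (here; there)

-- Pfaffians of words and their classical condensation identity.

module WordPfaffian {c ℓ} (R : CommutativeRing c ℓ) (I : Set)
  (a : I → I → CommutativeRing.Carrier R) where
  open CommutativeRing R hiding (zero)
  open Contraction R I

  -- Zero unless the word has length 2n.
  pf : ℕ → List I → Carrier
  pf zero    []      = 1#
  pf zero    (_ ∷ _) = 0#
  pf (suc n) []      = 0#
  pf (suc n) (x ∷ L) = ∂ (a x) (pf n) L

module Condensation {c ℓ} (R : CommutativeRing c ℓ) (I : Set)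
  (a : I → I → CommutativeRing.Carrier R)
  (skew : ∀ i j → CommutativeRing._≈_ R (a i j) (CommutativeRing.-_ R (a j i)))
  (diagonal : ∀ i → CommutativeRing._≈_ R (a i i) (CommutativeRing.0# R)) where
  open CommutativeRing R hiding (zero)
  open RingProperties ring
  open RingLemmas R
  open Contraction R I
  open WordPfaffian R I a
  open Alternating
  open SetoidReasoning setoid

  private
    -- Plays the part of `pf (n - 1)` with `pf (-1) = 0`, so that a single expansion along the first
    -- letter also covers `n = 0`.
    pred-pf : ℕ → List I → Carrier
    pred-pf zero    = λ _ → 0#
    pred-pf (suc n) = pf n

    pf-∷ : ∀ n y L → pf n (y ∷ L) ≈ ∂ (a y) (pred-pf n) L
    pf-∷ zero    y L = sym (∂-zeroʳ (a y) (λ _ → refl) L)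
    pf-∷ (suc n) y L = refl

    pf-∷∷ : ∀ n x y L → pf (suc n) (x ∷ y ∷ L) ≈ a x y * pf n L - ∂ (a x) (∂ (a y) (pred-pf n)) L
    pf-∷∷ n x y L = +-congˡ (-‿cong (∂-congˡ (a x) (pf-∷ n y) L))

  -- Splitting off two leading letters leaves `a x y * pf n L`, which changes sign by skewness, and
  -- a double contraction, which does so by `∂-anticomm`. Letters further right are left to
  -- `alternating-∂`.
  alternating-pf : ∀ n → Alternating (pf n)
  alternating-pf zero .transpose []      x y L = 0≈-0
  alternating-pf zero .transpose (_ ∷ _) x y L = 0≈-0
  alternating-pf zero .repeated  []      x L = refl
  alternating-pf zero .repeated  (_ ∷ _) x L = refl
  alternating-pf (suc n) .transpose [] x y L = begin
    pf (suc n) (x ∷ y ∷ L)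
      ≈⟨ pf-∷∷ n x y L ⟩
    a x y * pf n L - ∂ (a x) (∂ (a y) (pred-pf n)) L
      ≈⟨ -‿cong₂ (trans (*-congʳ (skew x y)) (sym (-‿distribˡ-* _ _))) (∂-anticomm (a x) (a y) _ L) ⟩
    - (a y x * pf n L) - - ∂ (a y) (∂ (a x) (pred-pf n)) L
      ≈⟨ -‿+-comm _ _ ⟩
    - (a y x * pf n L - ∂ (a y) (∂ (a x) (pred-pf n)) L)
      ≈⟨ -‿cong (pf-∷∷ n y x L) ⟨
    - pf (suc n) (y ∷ x ∷ L) ∎
  alternating-pf (suc n) .transpose (q ∷ P) =
    alternating-∂ (a q) (pf n) (alternating-pf n) .transpose P
  alternating-pf (suc n) .repeated [] x L = trans (pf-∷∷ n x x L)
    (trans (x-0≈x (∂²≈0 (a x) _ L)) (trans (*-congʳ (diagonal x)) (zeroˡ _)))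
  alternating-pf (suc n) .repeated (q ∷ P) =
    alternating-∂ (a q) (pf n) (alternating-pf n) .repeated P

  -- Both sides are Σ ± pf(I∖i) a(i,j) pf(J∖j), summed over the positions i of I and j of J.
  pf-exchange : ∀ n m I J →
    ∂ (λ i → pf (suc m) (i ∷ J)) (pf n) I ≈ - ∂ (λ j → pf (suc n) (j ∷ I)) (pf m) J
  pf-exchange n m I J = begin
    ∂ (λ i → ∂ (a i) (pf m) J) (pf n) I
      ≈⟨ ∂-exchange a (pf m) (pf n) I J ⟩
    ∂ (λ j → ∂ (λ i → a i j) (pf n) I) (pf m) J
      ≈⟨ ∂-cong (λ j → trans (∂-cong (λ i → skew i j) (λ _ → refl) I) (∂-neg (a j) (pf n) I)) (λ _ → refl) J ⟩
    ∂ (λ j → - ∂ (a j) (pf n) I) (pf m) J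
      ≈⟨ ∂-neg _ (pf m) J ⟩
    - ∂ (λ j → ∂ (a j) (pf n) I) (pf m) J ∎

  -- In `pf-exchange` every summand indexed by a letter of `Z` contains that letter twice and
  -- vanishes. Only `x` survives on one side, and `y`, `p`, `q` on the other; the even length of `Z`
  -- fixes their signs.
  pf-condensation : ∀ k x y Z p q → sign Z ≈ 1# →
    pf k Z * pf (2 ℕ.+ k) (x ∷ y ∷ Z ++ p ∷ q ∷ [])
      ≈ pf (1 ℕ.+ k) (Z ++ p ∷ q ∷ []) * pf (1 ℕ.+ k) (x ∷ y ∷ Z)
        - pf (1 ℕ.+ k) (y ∷ Z ++ q ∷ []) * pf (1 ℕ.+ k) (x ∷ Z ++ p ∷ [])
        + pf (1 ℕ.+ k) (y ∷ Z ++ p ∷ []) * pf (1 ℕ.+ k) (x ∷ Z ++ q ∷ [])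
  pf-condensation k x y Z p q even = begin
    pf k Z * pf (2 ℕ.+ k) (x ∷ J)
      ≈⟨ *-comm _ _ ⟩
    pf (2 ℕ.+ k) (x ∷ J) * pf k Z
      -- `Z` is read as `Z ++ []` so that `∂-skip` applies; the contraction of the empty remainder
      -- is zero.
      ≈⟨ x-0≈x (trans (reflexive (≡.cong (∂ g (pf k ∘ (x ∷_))) (≡.sym (++-identityʳ Z))))
           (trans (∂-skip g _ Z [] g-zero) (zeroʳ _))) ⟨
    ∂ g (pf k) (x ∷ Z)
      ≈⟨ pf-exchange k (suc k) (x ∷ Z) J ⟩
    - (h y * pf k′ (Z ++ p ∷ q ∷ []) - ∂ h (pf k′ ∘ (y ∷_)) (Z ++ p ∷ q ∷ []))
      ≈⟨ -‿cong (-‿cong₂ (*-congʳ h-y) (trans (∂-skip h _ Z _ h-zero)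
           (trans (*-congʳ even) (*-identityˡ _)))) ⟩
    - (- pf k′ (x ∷ y ∷ Z) * Zpq - (h p * yZq - (h q * yZp - 0#)))
      ≈⟨ -‿cong (-‿cong₂ (sym (-‿distribˡ-* _ _)) (-‿cong₂ (trans (*-congʳ (h-end p)) (sym (-‿distribˡ-* _ _)))
            (trans (x-0≈x refl) (trans (*-congʳ (h-end q)) (sym (-‿distribˡ-* _ _)))))) ⟩
    - (- (pf k′ (x ∷ y ∷ Z) * Zpq) - (- (xZp * yZq) - - (xZq * yZp)))
      ≈⟨ -‿cong (-‿cong₂ (-‿cong (*-comm _ _)) (-‿cong₂ (-‿cong (*-comm _ _)) (-‿cong (*-comm _ _)))) ⟩
    - (- u - (- v - - w))
      ≈⟨ -‿cong (-‿cong₂ refl (-‿+-comm v (- w))) ⟩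
    - (- u - - (v - w))
      ≈⟨ -‿cong (-‿+-comm u (- (v - w))) ⟩
    - - (u - (v - w))
      ≈⟨ -‿involutive _ ⟩
    u - (v - w)
      ≈⟨ nested-differences u v w ⟩
    u - v + w ∎
    where
    k′ : ℕ
    k′ = 1 ℕ.+ k
    J : List I
    J = y ∷ Z ++ p ∷ q ∷ []
    g h : I → Carrier
    g i = pf (2 ℕ.+ k) (i ∷ J)
    h j = pf k′ (j ∷ x ∷ Z)
    Zpq yZq yZp xZp xZq u v w : Carrier
    Zpq = pf k′ (Z ++ p ∷ q ∷ [])
    yZq = pf k′ (y ∷ Z ++ q ∷ [])
    yZp = pf k′ (y ∷ Z ++ p ∷ [])
    xZp = pf k′ (x ∷ Z ++ p ∷ [])
    xZq = pf k′ (x ∷ Z ++ q ∷ [])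
    u = Zpq * pf k′ (x ∷ y ∷ Z)
    v = yZq * xZp
    w = yZp * xZq
    g-zero : ∀ {z} → z ∈ Z → g z ≈ 0#
    g-zero z∈Z = alternating-∈ (alternating-pf (2 ℕ.+ k)) (there (∈-++⁺ˡ z∈Z))
    h-zero : ∀ {z} → z ∈ Z → h z ≈ 0#
    h-zero z∈Z = alternating-∈ (alternating-pf k′) (there z∈Z)
    h-y : h y ≈ - pf k′ (x ∷ y ∷ Z)
    h-y = alternating-pf k′ .transpose [] y x Z
    h-end : ∀ r → h r ≈ - pf k′ (x ∷ Z ++ r ∷ [])
    h-end r = begin
      pf k′ (r ∷ x ∷ Z)
        ≡⟨ ≡.cong (λ L → pf k′ (r ∷ x ∷ L)) (++-identityʳ Z) ⟨
      pf k′ (r ∷ x ∷ Z ++ [])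
        ≈⟨ insert-first (alternating-pf k′) r (x ∷ Z) [] ⟩
      - sign Z * pf k′ (x ∷ Z ++ r ∷ [])
        ≈⟨ *-congʳ (-‿cong even) ⟩
      - 1# * pf k′ (x ∷ Z ++ r ∷ [])
        ≈⟨ -1*x≈-x _ ⟩
      - pf k′ (x ∷ Z ++ r ∷ []) ∎

-- Relabelling of letters and completion to a skew matrix.

module WordSubstitution {c ℓ} (R : CommutativeRing c ℓ) {I J : Set} (σ : J → I) where
  open CommutativeRing R hiding (zero)

  ∂-map : ∀ g f L → Contraction.∂ R I g f (map σ L) ≈ Contraction.∂ R J (g ∘ σ) (f ∘ map σ) L
  ∂-map g f []      = refl
  ∂-map g f (y ∷ L) = +-congˡ (-‿cong (∂-map g (f ∘ (σ y ∷_)) L))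

  pf-map : ∀ a n L → WordPfaffian.pf R I a n (map σ L) ≈ WordPfaffian.pf R J (λ i j → a (σ i) (σ j)) n L
  pf-map a zero    []      = refl
  pf-map a zero    (_ ∷ _) = refl
  pf-map a (suc n) []      = refl
  pf-map a (suc n) (x ∷ L) = trans (∂-map (a (σ x)) _ L) (Contraction.∂-congˡ R J _ (pf-map a n) L)

module SkewClosure {c ℓ} (R : CommutativeRing c ℓ) {N} (g : Fin N → Fin N → CommutativeRing.Carrier R) where
  open CommutativeRing R hiding (zero)
  open RingProperties ring

  -- In the application the factor `λ^j` depends on the second index only, so the weighted matrix is
  -- not skew; only its entries above the diagonal are kept.
  closure : Fin N → Fin N → Carrier
  closure i j with <-cmp i j
  ... | tri< _ _ _ = g i j
  ... | tri≈ _ _ _ = 0#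
  ... | tri> _ _ _ = - g j i

  closure-< : ∀ {i j} → i < j → closure i j ≈ g i j
  closure-< {i} {j} i<j with <-cmp i j
  ... | tri< _ _ _   = refl
  ... | tri≈ i≮j _ _ = ⊥-elim (i≮j i<j)
  ... | tri> i≮j _ _ = ⊥-elim (i≮j i<j)

  closure-diagonal : ∀ i → closure i i ≈ 0#
  closure-diagonal i with <-cmp i i
  ... | tri< _ i≢i _ = ⊥-elim (i≢i ≡.refl)
  ... | tri≈ _ _ _   = refl
  ... | tri> _ i≢i _ = ⊥-elim (i≢i ≡.refl)

  closure-skew : ∀ i j → closure i j ≈ - closure j i
  closure-skew i j with <-cmp i j | <-cmp j i
  ... | tri< _ _ _   | tri> _ _ _   = sym (-‿involutive _)
  ... | tri> _ _ _   | tri< _ _ _   = refl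
  ... | tri≈ _ _ _   | tri≈ _ _ _   = sym -0#≈0#
  ... | tri< _ _ j≮i | tri< j<i _ _ = ⊥-elim (j≮i j<i)
  ... | tri< _ i≢j _ | tri≈ _ j≡i _ = ⊥-elim (i≢j (≡.sym j≡i))
  ... | tri≈ _ i≡j _ | tri< _ j≢i _ = ⊥-elim (j≢i (≡.sym i≡j))
  ... | tri≈ _ i≡j _ | tri> _ j≢i _ = ⊥-elim (j≢i (≡.sym i≡j))
  ... | tri> _ i≢j _ | tri≈ _ j≡i _ = ⊥-elim (i≢j (≡.sym j≡i))
  ... | tri> i≮j _ _ | tri> _ _ i<j = ⊥-elim (i≮j i<j)

-- Enumeration of perfect matchings.

module Matchings where
  open import Data.Nat.Base using (_+_; _*_)
  open import Relation.Binary.PropositionalEquality using (refl; cong; cong₂; subst)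

  private
    variable
      n N : ℕ

  Arc : ℕ → Set
  Arc N = Fin N × Fin N

  Sorted : List (Fin N) → Set
  Sorted = AllPairs _<_

  sorted⇒unique : {S : List (Fin N)} → Sorted S → Unique S
  sorted⇒unique = AllPairs.map Fin.<⇒≢

  sorted-allFin : ∀ N → Sorted (allFin N)
  sorted-allFin zero    = []
  sorted-allFin (suc N) = All.tabulate⁺ (λ _ → ℕ.s≤s ℕ.z≤n)
    ∷ subst Sorted (map-tabulate id suc) (AllPairs.map⁺ (AllPairs.map ℕ.s≤s (sorted-allFin N)))

  endpoints : Vec (Arc N) n → List (Fin N)
  endpoints []            = []
  endpoints ((a , b) ∷ m) = a ∷ b ∷ endpoints m

  picks : ∀ {A : Set} → List A → List (A × List A)
  picks []      = []
  picks (y ∷ L) = (y , L) ∷ map (λ (b , R) → b , y ∷ R) (picks L)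

  -- The recursion mirrors the expansion of `pf` along its first letter, so that the two can be
  -- compared term by term.
  matchings : ∀ n → List (Fin N) → List (Vec (Arc N) n)
  matchings zero    []      = [] ∷ []
  matchings zero    (_ ∷ _) = []
  matchings (suc n) []      = []
  matchings (suc n) (s ∷ S) = concatMap (λ (b , R) → map ((s , b) ∷_) (matchings n R)) (picks S)

  module _ {A : Set} where

    picks-↭ : ∀ {b} {R : List A} L → (b , R) ∈ picks L → L ↭ b ∷ R
    picks-↭ (y ∷ L) (here refl) = ↭-refl
    picks-↭ (y ∷ L) (there i) with (b , R) , j , refl ← ∈-map⁻ _ i =
      ↭-trans (↭-prep y (picks-↭ L j)) (↭-swap y b ↭-refl)

    ∈-picks : ∀ {b} {L : List A} → b ∈ L → ∃ λ R → (b , R) ∈ picks L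
    ∈-picks (here refl) = _ , here refl
    ∈-picks (there i) with R , j ← ∈-picks i = _ , there (∈-map⁺ _ j)

    map-proj₁-picks : (L : List A) → map proj₁ (picks L) ≡ L
    map-proj₁-picks []      = refl
    map-proj₁-picks (y ∷ L) = cong (y ∷_) (≡.trans (≡.sym (map-∘ (picks L))) (map-proj₁-picks L))

  sorted-picks : ∀ {b R} (L : List (Fin N)) → Sorted L → (b , R) ∈ picks L → Sorted R
  sorted-picks (y ∷ L) (_ ∷ s) (here refl) = s
  sorted-picks (y ∷ L) (y< ∷ s) (there i) with _ , j , refl ← ∈-map⁻ _ i =
    All.tail (All-resp-↭ (picks-↭ L j) y<) ∷ sorted-picks L s j

  -- A permutation condition, in contrast to covering, survives the removal of an arc in an evident
  -- way. It also makes sense for the words `S` left over in the recursion, which are not intervals.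
  IsMatchingOf : List (Fin N) → Vec (Arc N) n → Set
  IsMatchingOf S m =
      VecAll.All (λ (a , b) → a < b) m
    × Linked (λ (a , _) (c , _) → a < c) m
    × endpoints m ↭ S

  ∈-matchings⇒isMatchingOf : ∀ n {S : List (Fin N)} {m} → Sorted S → m ∈ matchings n S → IsMatchingOf S m
  ∈-matchings⇒isMatchingOf zero    {[]} s (here refl) = [] , [] , ↭-refl
  ∈-matchings⇒isMatchingOf (suc n) {x ∷ S} (x< ∷ s) i
    with (b , R) , j , k ← find (∈-concatMap⁻ _ {xs = picks S} i)
    with m , l , refl ← ∈-map⁻ _ k
    with ordered , linked , p ← ∈-matchings⇒isMatchingOf n (sorted-picks S s j) l
    with x<b ∷ x<R ← All-resp-↭ (picks-↭ S j) x<
    = x<b ∷ ordered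
    , link m linked (All-resp-↭ (↭-sym p) x<R)
    , ↭-prep x (↭-trans (↭-prep b p) (↭-sym (picks-↭ S j)))
    where

    link : ∀ {b n} (m : Vec (Arc _) n) → Linked (λ (a , _) (c , _) → a < c) m →
           All (x <_) (endpoints m) → Linked (λ (a , _) (c , _) → a < c) ((x , b) ∷ m)
    link []      l _         = [-]
    link (_ ∷ _) l (x<c ∷ _) = x<c ∷ l

  first-least : ∀ {a b} {m : Vec (Arc N) n} →
    VecAll.All (λ (a , b) → a < b) ((a , b) ∷ m) → Linked (λ (a , _) (c , _) → a < c) ((a , b) ∷ m) →
    All (a <_) (b ∷ endpoints m)
  first-least {m = []}    (a<b ∷ _) _ = a<b ∷ []
  first-least {m = _ ∷ m} (a<b ∷ o) (a<c ∷ l) = a<b ∷ a<c ∷ All.map (Fin.<-trans a<c) (first-least o l)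

  -- If the first opener and the least letter differed, each would be smaller than the other.
  first-≡-least : ∀ {a b x} {S : List (Fin N)} {m : Vec (Arc N) n} →
    All (x <_) S → IsMatchingOf (x ∷ S) ((a , b) ∷ m) → a ≡ x
  first-≡-least x< (o , l , p) with ∈-resp-↭ p (here refl) | ∈-resp-↭ (↭-sym p) (here refl)
  ... | here a≡x  | _          = a≡x
  ... | there _   | here x≡a   = ≡.sym x≡a
  ... | there a∈S | there x∈   = ⊥-elim (Fin.<-asym (All.lookup x< a∈S) (All.lookup (first-least o l) x∈))

  isMatchingOf⇒∈-matchings : {S : List (Fin N)} (m : Vec (Arc N) n) → Sorted S → IsMatchingOf S m → m ∈ matchings n S
  isMatchingOf⇒∈-matchings [] s (_ , _ , p) with refl ← ↭-empty-inv (↭-sym p) = here refl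
  isMatchingOf⇒∈-matchings {S = []} (_ ∷ m) s (_ , _ , p) with () ← ↭-empty-inv p
  isMatchingOf⇒∈-matchings {n = suc n} {S = x ∷ S} ((a , b) ∷ m) (x< ∷ s) (o@(_ ∷ o′) , l , p)
    with refl ← first-≡-least x< (o , l , p)
    with q ← drop-∷ p
    with R , j ← ∈-picks (∈-resp-↭ q (here refl))
    = ∈-concatMap⁺ _ (Any.map (λ { refl → ∈-map⁺ _
        (isMatchingOf⇒∈-matchings m (sorted-picks S s j)
          (o′ , Linked.tail l , drop-∷ (↭-trans q (picks-↭ S j)))) }) j)

  -- Different partners of `x` give disjoint blocks, and no partner repeats because the first
  -- components of `picks S` are `S` itself.
  unique-matchings : ∀ n {S : List (Fin N)} → Sorted S → Unique (matchings n S)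
  unique-matchings zero    {[]}    s = [] ∷ []
  unique-matchings zero    {_ ∷ _} s = []
  unique-matchings (suc n) {[]}    s = []
  unique-matchings (suc n) {x ∷ S} (_ ∷ s) = Unique.concat⁺
    (All.map⁺ (All.tabulate λ i → Unique.map⁺ (proj₂ ∘ ∷-injective) (unique-matchings n (sorted-picks S s i))))
    (AllPairs.map⁺ (AllPairs.map disjoint (AllPairs.map⁻ (subst Unique (≡.sym (map-proj₁-picks S)) (sorted⇒unique s)))))
    where
    disjoint : ∀ {b b′ R R′} → b ≢ b′ → ∀ {m} →
      ¬ (m ∈ map ((x , b) ∷_) (matchings n R) × m ∈ map ((x , b′) ∷_) (matchings n R′))
    disjoint b≢b′ (i , j) with _ , _ , refl ← ∈-map⁻ _ i with _ , _ , e ← ∈-map⁻ _ j =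
      b≢b′ (cong proj₂ (proj₁ (∷-injective e)))

  -- Pigeonhole. It turns covering into a permutation: `2n` endpoints that hit all `2n` positions
  -- hit each exactly once.
  unique-⊆-↭ : ∀ {A : Set} {S L : List A} → Unique S → (∀ {x} → x ∈ S → x ∈ L) → length L ≡ length S → L ↭ S
  unique-⊆-↭ {S = []}    {[]} u sub len = ↭-refl
  unique-⊆-↭ {S = x ∷ S} {L} (x∉S ∷ u) sub len with K , M , refl ← ∈-∃++ (sub (here refl)) =
    ↭-trans (shift x K M) (↭-prep x (unique-⊆-↭ u sub′ (ℕ.suc-injective
      (≡.trans (≡.sym (↭-length (shift x K M))) len))))
    where
    sub′ : ∀ {y} → y ∈ S → y ∈ K ++ M
    sub′ y∈S with ∈-resp-↭ (shift x K M) (sub (there y∈S))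
    ... | here refl = ⊥-elim (All.lookup x∉S y∈S refl)
    ... | there i   = i

  length-endpoints : (m : Vec (Arc N) n) → length (endpoints m) ≡ n * 2
  length-endpoints []      = refl
  length-endpoints (_ ∷ m) = cong (2 +_) (length-endpoints m)

  isPerfectMatching⇒isMatchingOf : (m : Pairs n) → IsPerfectMatching m → IsMatchingOf (allFin (n * 2)) m
  isPerfectMatching⇒isMatchingOf {n} m (o , l , cover) = o , l ,
    unique-⊆-↭ (Unique.allFin⁺ (n * 2)) (λ {x} _ → covered m (cover x))
      (≡.trans (length-endpoints m) (≡.sym (length-tabulate id)))
    where
    covered : ∀ {x n} (m : Vec (Arc N) n) → VecAny.Any (λ (a , b) → x ≡ a ⊎ x ≡ b) m → x ∈ endpoints m
    covered (_ ∷ m) (here (inj₁ e)) = here e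
    covered (_ ∷ m) (here (inj₂ e)) = there (here e)
    covered (_ ∷ m) (there i)       = there (there (covered m i))

  isMatchingOf⇒isPerfectMatching : (m : Pairs n) → IsMatchingOf (allFin (n * 2)) m → IsPerfectMatching m
  isMatchingOf⇒isPerfectMatching m (o , l , p) = o , l , λ x → cover m (∈-resp-↭ (↭-sym p) (∈-allFin x))
    where
    cover : ∀ {x n} (m : Vec (Arc N) n) → x ∈ endpoints m → VecAny.Any (λ (a , b) → x ≡ a ⊎ x ≡ b) m
    cover (_ ∷ m) (here e)          = here (inj₁ e)
    cover (_ ∷ m) (there (here e))  = here (inj₂ e)
    cover (_ ∷ m) (there (there i)) = there (cover m i)

  module _ {A : Set} where

    ∈-allVecs : ∀ {xs : List A} → (∀ x → x ∈ xs) → ∀ {n} (v : Vec A n) → v ∈ allVecs xs n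
    ∈-allVecs all []      = here refl
    ∈-allVecs all (x ∷ v) = ∈-cartesianProductWith⁺ _∷_ (all x) (∈-allVecs all v)

    unique-allVecs : ∀ {xs : List A} → Unique xs → ∀ n → Unique (allVecs xs n)
    unique-allVecs u zero    = [] ∷ []
    unique-allVecs u (suc n) = Unique.cartesianProductWith⁺ _∷_ ∷-injective u (unique-allVecs u n)

  -- Both lists are free of duplicates and have the same members. Their orders may differ, which is
  -- harmless under a sum.
  perfectMatchings-↭ : ∀ n → perfectMatchings n ↭ matchings n (allFin (n * 2))
  perfectMatchings-↭ n = ∼bag⇒↭ (unique∧set⇒bag
    (Unique.filter⁺ isPerfectMatching? (unique-allVecs (Unique.cartesianProduct⁺ u u) n))
    (unique-matchings n s)
    (mk⇔ (λ i → isMatchingOf⇒∈-matchings _ s (isPerfectMatching⇒isMatchingOf _ (proj₂ (∈-filter⁻ isPerfectMatching? {xs = allVecs _ n} i))))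
         (λ i → ∈-filter⁺ isPerfectMatching? (∈-allVecs (λ (a , b) → ∈-cartesianProduct⁺ (∈-allFin a) (∈-allFin b)) _)
                  (isMatchingOf⇒isPerfectMatching _ (∈-matchings⇒isMatchingOf n s i)))))
    where
    u = Unique.allFin⁺ (n * 2)
    s = sorted-allFin (n * 2)

  -- Counting by sums of indicators.

  indicator : ∀ {P : Set} → Dec P → ℕ
  indicator P? = if does P? then 1 else 0

  indicator-yes : ∀ {P : Set} (P? : Dec P) → P → indicator P? ≡ 1
  indicator-yes P? p rewrite dec-true P? p = refl

  indicator-no : ∀ {P : Set} (P? : Dec P) → ¬ P → indicator P? ≡ 0
  indicator-no P? ¬p rewrite dec-false P? ¬p = refl

  indicator-× : ∀ {P Q : Set} (P? : Dec P) (Q? : Dec Q) → indicator (P? ×-dec Q?) ≡ indicator P? * indicator Q?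
  indicator-× P? Q? with does P? | does Q?
  ... | true  | true  = refl
  ... | true  | false = refl
  ... | false | _     = refl

  sumOver : ∀ {A : Set} → (A → ℕ) → Vec A n → ℕ
  sumOver f []      = 0
  sumOver f (x ∷ v) = f x + sumOver f v

  sumOver-map : ∀ {A B : Set} (f : A → ℕ) (h : B → A) (v : Vec B n) → sumOver f (Vec.map h v) ≡ sumOver (f ∘ h) v
  sumOver-map f h []      = refl
  sumOver-map f h (x ∷ v) = cong (f (h x) +_) (sumOver-map f h v)

  module _ {A : Set} where

    sumOver-cong : ∀ {f g : A → ℕ} {v : Vec A n} → VecAll.All (λ x → f x ≡ g x) v → sumOver f v ≡ sumOver g v
    sumOver-cong []      = refl
    sumOver-cong (e ∷ es) = cong₂ _+_ e (sumOver-cong es)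

    sumOver-+ : ∀ (f g : A → ℕ) (v : Vec A n) → sumOver (λ x → f x + g x) v ≡ sumOver f v + sumOver g v
    sumOver-+ f g []      = refl
    sumOver-+ f g (x ∷ v) rewrite sumOver-+ f g v =
      solve 4 (λ a b c d → a :+ b :+ (c :+ d) := a :+ c :+ (b :+ d)) refl (f x) (g x) (sumOver f v) (sumOver g v)
      where open +-*-Solver

    sumOver-const : ∀ c (v : Vec A n) → sumOver (λ _ → c) v ≡ n * c
    sumOver-const c []      = refl
    sumOver-const c (_ ∷ v) = cong (c +_) (sumOver-const c v)

    sumOver-++ : ∀ {k} (f : A → ℕ) (v : Vec A n) (w : Vec A k) → sumOver f (v Vec.++ w) ≡ sumOver f v + sumOver f w
    sumOver-++ f []      w = refl
    sumOver-++ f (x ∷ v) w = ≡.trans (cong (f x +_) (sumOver-++ f v w)) (≡.sym (ℕ.+-assoc (f x) _ _))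

    count-sumOver : ∀ {P : A → Set} (P? : Decidable P) (v : Vec A n) → count P? v ≡ sumOver (indicator ∘ P?) v
    count-sumOver P? []      = refl
    count-sumOver P? (x ∷ v) with does (P? x)
    ... | true  = cong suc (count-sumOver P? v)
    ... | false = count-sumOver P? v

  module _ {A : Set} where

    pairSum : (A → A → ℕ) → Vec A n → ℕ
    pairSum f v = sumOver (λ x → sumOver (f x) v) v

    sumOver-allPairs : ∀ {k} (f : A × A → ℕ) (v : Vec A n) (w : Vec A k) →
      sumOver f (allPairs v w) ≡ sumOver (λ x → sumOver (λ y → f (x , y)) w) v
    sumOver-allPairs f []      w = refl
    sumOver-allPairs f (x ∷ v) w = ≡.trans (sumOver-++ f (Vec.map (x ,_) w) _)
      (cong₂ _+_ (sumOver-map f (x ,_) w) (sumOver-allPairs f v w))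

    count-allPairs : ∀ {P : A × A → Set} (P? : Decidable P) (v : Vec A n) →
      count P? (allPairs v v) ≡ pairSum (λ x y → indicator (P? (x , y))) v
    count-allPairs P? v = ≡.trans (count-sumOver P? (allPairs v v)) (sumOver-allPairs _ v v)

    pairSum-+ : ∀ (f g : A → A → ℕ) (v : Vec A n) → pairSum (λ x y → f x y + g x y) v ≡ pairSum f v + pairSum g v
    pairSum-+ f g v = ≡.trans (sumOver-cong (VecAll.universal (λ x → sumOver-+ (f x) (g x) v) v)) (sumOver-+ _ _ v)

    pairSum-∷ : ∀ (f : A → A → ℕ) x (v : Vec A n) →
      pairSum f (x ∷ v) ≡ f x x + sumOver (λ y → f x y + f y x) v + pairSum f v
    pairSum-∷ f x v = begin
      f x x + sumOver (f x) v + sumOver (λ y → f y x + sumOver (f y) v) v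
        ≡⟨ cong (f x x + sumOver (f x) v +_) (sumOver-+ (λ y → f y x) _ v) ⟩
      f x x + sumOver (f x) v + (sumOver (λ y → f y x) v + pairSum f v)
        ≡⟨ ℕ.+-assoc (f x x + sumOver (f x) v) _ _ ⟨
      f x x + sumOver (f x) v + sumOver (λ y → f y x) v + pairSum f v
        ≡⟨ cong (_+ pairSum f v) (≡.trans (ℕ.+-assoc (f x x) _ _) (cong (f x x +_) (≡.sym (sumOver-+ (f x) _ v)))) ⟩
      f x x + sumOver (λ y → f x y + f y x) v + pairSum f v ∎
      where open ≡.≡-Reasoning

  -- Crossings, nestings and the positions of closers.

  crossing nesting : Arc N → Arc N → ℕ
  crossing (a , b) (c , d) = indicator ((a <? c) ×-dec (c <? b) ×-dec (b <? d))
  nesting  (a , b) (c , d) = indicator ((a <? c) ×-dec (c <? d) ×-dec (d <? b))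

  -- Summed over the second arc of a perfect matching, this gives the position of the closer `b`,
  -- positions being counted from 0.
  before-closer : Arc N → Arc N → ℕ
  before-closer (a , b) (c , d) = indicator (c <? b) + indicator (d <? b)

  cross-pairSum : (m : Pairs n) → cross m ≡ pairSum crossing m
  cross-pairSum = count-allPairs _

  nest-pairSum : (m : Pairs n) → nest m ≡ pairSum nesting m
  nest-pairSum = count-allPairs _

  Increasing : Arc N → Set
  Increasing (a , b) = a < b

  Precedes : Arc N → Arc N → Set
  Precedes (a , b) (c , d) = a < c × c < d × b ≢ c × b ≢ d

  -- Compares each arc with all later ones, whereas `Linked` compares neighbours. Statistics on
  -- pairs then reduce to the three relative positions of two arcs: disjoint, crossing, nested.
  data Arranged {N} : ∀ {n} → Vec (Arc N) n → Set where
    []  : Arranged []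
    _∷_ : ∀ {n p} {m : Vec (Arc N) n} → Increasing p × VecAll.All (Precedes p) m → Arranged m → Arranged (p ∷ m)

  isMatchingOf⇒arranged : {S : List (Fin N)} (m : Vec (Arc N) n) → Unique S → IsMatchingOf S m → Arranged m
  isMatchingOf⇒arranged {N} m u (o , l , p) = arrange m o l
    (Unique-resp-↭ (≡.setoid _) (↭⇒↭ₛ (↭-sym p)) u)
    where
    precede : ∀ {a b n} (m : Vec (Arc N) n) → VecAll.All Increasing m →
              All (a <_) (endpoints m) → All (b ≢_) (endpoints m) → VecAll.All (Precedes (a , b)) m
    precede []            []        []            []              = []
    precede ((c , d) ∷ m) (c<d ∷ o) (a<c ∷ _ ∷ r) (b≢c ∷ b≢d ∷ s) = (a<c , c<d , b≢c , b≢d) ∷ precede m o r s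

    arrange : ∀ {n} (m : Vec (Arc N) n) → VecAll.All Increasing m → Linked (λ (a , _) (c , _) → a < c) m →
              Unique (endpoints m) → Arranged m
    arrange []            o             l u                  = []
    arrange ((a , b) ∷ m) o@(a<b ∷ o′)  l (_ ∷ b∉ ∷ u) =
      (a<b , precede m o′ (All.tail (first-least o l)) b∉) ∷ arrange m o′ (Linked.tail l) u

  -- A pair of distinct arcs enters the sum in both orders, so agreement of the symmetrised summands
  -- suffices.
  pairSum-arranged : ∀ {f g : Arc N → Arc N → ℕ} → (∀ p → Increasing p → f p p ≡ g p p) →
    (∀ p q → Increasing p → Precedes p q → f p q + f q p ≡ g p q + g q p) →
    {m : Vec (Arc N) n} → Arranged m → pairSum f m ≡ pairSum g m
  pairSum-arranged e h [] = refl
  pairSum-arranged {f = f} {g} e h {p ∷ m} ((a<b , pre) ∷ arr) = begin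
    pairSum f (p ∷ m)
      ≡⟨ pairSum-∷ f p m ⟩
    f p p + sumOver (λ q → f p q + f q p) m + pairSum f m
      ≡⟨ cong₂ _+_ (cong₂ _+_ (e p a<b) (sumOver-cong (VecAll.map (h p _ a<b) pre))) (pairSum-arranged e h arr) ⟩
    g p p + sumOver (λ q → g p q + g q p) m + pairSum g m
      ≡⟨ pairSum-∷ g p m ⟨
    pairSum g (p ∷ m) ∎
    where open ≡.≡-Reasoning

  module _ {N} {a b : Fin N} (a<b : a < b) where

    private
      value-yes : {i j : Fin N} → i < j → indicator (i <? j) ≡ 1
      value-yes = indicator-yes (_ <? _)

      value-no : {i j : Fin N} → j < i → indicator (i <? j) ≡ 0
      value-no j<i = indicator-no (_ <? _) (Fin.<-asym j<i)

      value-irrefl : (i : Fin N) → indicator (i <? i) ≡ 0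
      value-irrefl i = indicator-no (i <? i) (ℕ.<-irrefl {toℕ i} refl)

    crossing-self : crossing (a , b) (a , b) ≡ 0
    crossing-self rewrite indicator-× (a <? a) ((a <? b) ×-dec (b <? b)) | value-irrefl a = refl

    before-closer-self : before-closer (a , b) (a , b) ≡ 1
    before-closer-self rewrite value-yes a<b | value-irrefl b = refl

    module _ {c d : Fin N} (pre : Precedes (a , b) (c , d)) where

      private
        a<c : a < c
        a<c = proj₁ pre

        c<d : c < d
        c<d = proj₁ (proj₂ pre)

        b≢d : b ≢ d
        b≢d = proj₂ (proj₂ (proj₂ pre))

      crossing-precedes : crossing (a , b) (c , d) ≡ indicator (c <? b) * indicator (b <? d)
      crossing-precedes rewrite indicator-× (a <? c) ((c <? b) ×-dec (b <? d)) | value-yes a<c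
        | indicator-× (c <? b) (b <? d) = ℕ.+-identityʳ _

      crossing-precedes⁻ : crossing (c , d) (a , b) ≡ 0
      crossing-precedes⁻ rewrite indicator-× (c <? a) ((a <? d) ×-dec (d <? b)) | value-no a<c = refl

      nesting-precedes : nesting (a , b) (c , d) ≡ indicator (d <? b)
      nesting-precedes rewrite indicator-× (a <? c) ((c <? d) ×-dec (d <? b)) | value-yes a<c
        | indicator-× (c <? d) (d <? b) | value-yes c<d = ≡.trans (ℕ.+-identityʳ _) (ℕ.+-identityʳ _)

      nesting-precedes⁻ : nesting (c , d) (a , b) ≡ 0
      nesting-precedes⁻ rewrite indicator-× (c <? a) ((a <? b) ×-dec (b <? d)) | value-no a<c = refl

      -- A later arc has no, one or both endpoints left of `b` according as it is disjoint from,
      -- crosses or is nested in the earlier arc. The 2 of a nested arc disappears from signs.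
      before-closer-crossing : before-closer (a , b) (c , d)
        ≡ crossing (a , b) (c , d) + crossing (c , d) (a , b) + 2 * indicator (d <? b)
      before-closer-crossing rewrite crossing-precedes | crossing-precedes⁻ with <-cmp b d
      ... | tri≈ _ b≡d _ = ⊥-elim (b≢d b≡d)
      ... | tri< b<d _ _ rewrite value-no b<d | value-yes b<d =
        solve 1 (λ x → x :+ con 0 := x :* con 1 :+ con 0 :+ con 0) refl (indicator (c <? b)) where open +-*-Solver
      ... | tri> _ _ d<b rewrite value-yes d<b | value-no d<b | value-yes (Fin.<-trans c<d d<b) = refl

      -- The larger closer has both endpoints of the other arc on its left, which gives 2. The
      -- smaller closer has the other opener on its left exactly when the arcs cross or nest.
      before-closer-nest : crossing (a , b) (c , d) + nesting (a , b) (c , d) + 1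
          + (crossing (c , d) (a , b) + nesting (c , d) (a , b) + 1)
        ≡ before-closer (a , b) (c , d) + before-closer (c , d) (a , b)
      before-closer-nest
        rewrite crossing-precedes | crossing-precedes⁻ | nesting-precedes | nesting-precedes⁻
          | value-yes (Fin.<-trans a<c c<d) with <-cmp b d
      ... | tri≈ _ b≡d _ = ⊥-elim (b≢d b≡d)
      ... | tri< b<d _ _ rewrite value-no b<d | value-yes b<d =
        solve 1 (λ x → x :* con 1 :+ con 0 :+ con 1 :+ con 1 := x :+ con 0 :+ con 2) refl (indicator (c <? b)) where open +-*-Solver
      ... | tri> _ _ d<b rewrite value-yes d<b | value-no d<b | value-yes (Fin.<-trans c<d d<b) = refl

  sumOver-endpoints : ∀ (f : Fin N → ℕ) (m : Vec (Arc N) n) →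
    ℕ.sum (map f (endpoints m)) ≡ sumOver (λ (a , b) → f a + f b) m
  sumOver-endpoints f []            = refl
  sumOver-endpoints f ((a , b) ∷ m) rewrite sumOver-endpoints f m = ≡.sym (ℕ.+-assoc (f a) _ _)

  sum-zeros : ∀ N → ℕ.sum (tabulate {n = N} (λ _ → 0)) ≡ 0
  sum-zeros zero    = refl
  sum-zeros (suc N) = sum-zeros N

  sum-allFin-< : (b : Fin N) → ℕ.sum (map (λ x → indicator (x <? b)) (allFin N)) ≡ toℕ b
  sum-allFin-< {N} b = ≡.trans (cong ℕ.sum (map-tabulate {n = N} id (λ x → indicator (x <? b)))) (below b)
    where
    below : ∀ {N} (b : Fin N) → ℕ.sum (tabulate {n = N} (λ x → indicator (x <? b))) ≡ toℕ b
    below {suc N} zero    = sum-zeros N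
    below {suc N} (suc b) = cong suc (below {N} b)

  sum-allFin-≟ : (b : Fin N) → ℕ.sum (map (λ x → indicator (x ≟ b)) (allFin N)) ≡ 1
  sum-allFin-≟ {N} b = ≡.trans (cong ℕ.sum (map-tabulate {n = N} id _)) (at b)
    where
    at : ∀ {N} (b : Fin N) → ℕ.sum (tabulate (λ x → indicator (x ≟ b))) ≡ 1
    at {suc N} zero    = cong suc (sum-zeros N)
    at {suc N} (suc b) = at {N} b

  sumOver-perfectMatching : ∀ (f : Fin (n * 2) → ℕ) (m : Pairs n) → IsPerfectMatching m →
    sumOver (λ (a , b) → f a + f b) m ≡ ℕ.sum (map f (allFin (n * 2)))
  sumOver-perfectMatching f m pm = ≡.trans (≡.sym (sumOver-endpoints f m))
    (ℕ.sum-↭ (map⁺ f (proj₂ (proj₂ (isPerfectMatching⇒isMatchingOf m pm)))))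

  -- Each position is the number of positions below it, and all of these are endpoints, so the sum
  -- of closers is a pair sum of `before-closer`. The constant 1 on all ordered pairs, diagonal
  -- included, supplies `n * n`.
  closers-matching : (m : Pairs n) → IsPerfectMatching m →
    sumOver (toℕ ∘ proj₂) m ≡ n * n + (cross m + nest m)
  closers-matching {n} m pm with M@(o , l , p) ← isPerfectMatching⇒isMatchingOf m pm = begin
    sumOver (toℕ ∘ proj₂) m
      ≡⟨ sumOver-cong (VecAll.universal (λ (a , b) → inner b) m) ⟨
    pairSum before-closer m
      ≡⟨ pairSum-arranged (λ _ → self) (λ _ _ a<b pre → before-closer-nest a<b pre)
          (isMatchingOf⇒arranged m (Unique.allFin⁺ _) M) ⟨
    pairSum (λ p q → crossing p q + nesting p q + 1) m
      ≡⟨ pairSum-+ _ _ m ⟩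
    pairSum (λ p q → crossing p q + nesting p q) m + pairSum (λ p q → 1) m
      ≡⟨ cong₂ _+_ (pairSum-+ _ _ m) (≡.trans (sumOver-const _ m) (cong (n *_) (≡.trans (sumOver-const 1 m) (ℕ.*-identityʳ n)))) ⟩
    pairSum crossing m + pairSum nesting m + n * n
      ≡⟨ cong (_+ n * n) (cong₂ _+_ (cross-pairSum m) (nest-pairSum m)) ⟨
    cross m + nest m + n * n
      ≡⟨ ℕ.+-comm (cross m + nest m) (n * n) ⟩
    n * n + (cross m + nest m) ∎
    where
    open ≡.≡-Reasoning
    self : ∀ {p : Arc (n * 2)} → Increasing p → crossing p p + nesting p p + 1 ≡ before-closer p p
    self a<b rewrite crossing-self a<b | before-closer-self a<b = refl

    inner : ∀ b → sumOver (λ (c , d) → indicator (c <? b) + indicator (d <? b)) m ≡ toℕ b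
    inner b = ≡.trans (sumOver-perfectMatching (λ x → indicator (x <? b)) m pm) (sum-allFin-< b)

  -- The greatest position cannot open an arc, so the one arc that contains it closes there.
  closes-last : (m : Pairs n) → IsPerfectMatching m → (z : Fin (n * 2)) → (∀ x → ¬ z < x) →
    sumOver (λ (_ , b) → indicator (b ≟ z)) m ≡ 1
  closes-last m pm@(o , _) z greatest = begin
    sumOver (λ (_ , b) → indicator (b ≟ z)) m
      ≡⟨ sumOver-cong (VecAll.map (λ {(a , b)} a<b → cong (_+ indicator (b ≟ z))
           (indicator-no (a ≟ z) λ { refl → greatest b a<b })) o) ⟨
    sumOver (λ (a , b) → indicator (a ≟ z) + indicator (b ≟ z)) m
      ≡⟨ sumOver-perfectMatching (λ x → indicator (x ≟ z)) m pm ⟩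
    ℕ.sum (map (λ x → indicator (x ≟ z)) (allFin _))
      ≡⟨ sum-allFin-≟ z ⟩
    1 ∎
    where open ≡.≡-Reasoning

  -- The first element never closes an arc, so its weight is irrelevant.
  weighted-closers : ∀ c t (w : Fin (n * 2) → ℕ) (z : Fin (n * 2)) → (∀ x → ¬ z < x) →
    (∀ {a b} → a < b → w b ≡ c + toℕ b + t * indicator (b ≟ z)) →
    (m : Pairs n) → IsPerfectMatching m →
    sumOver (w ∘ proj₂) m ≡ n * n + (n * c + t) + (cross m + nest m)
  weighted-closers {n} c t w z greatest e m pm@(o , _) = begin
    sumOver (w ∘ proj₂) m
      ≡⟨ sumOver-cong (VecAll.map (λ a<b → e a<b) o) ⟩
    sumOver (λ (_ , b) → c + toℕ b + t * indicator (b ≟ z)) m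
      ≡⟨ sumOver-+ _ _ m ⟩
    sumOver (λ (_ , b) → c + toℕ b) m + sumOver (λ (_ , b) → t * indicator (b ≟ z)) m
      ≡⟨ cong₂ _+_ (≡.trans (sumOver-+ _ _ m) (cong₂ _+_ (sumOver-const c m) (closers-matching m pm)))
           (≡.trans (sumOver-* t _ m) (≡.trans (cong (t *_) (closes-last m pm z greatest)) (ℕ.*-identityʳ t))) ⟩
    n * c + (n * n + (cross m + nest m)) + t
      ≡⟨ solve 4 (λ u v x t → u :+ (v :+ x) :+ t := v :+ (u :+ t) :+ x) refl (n * c) (n * n) (cross m + nest m) t ⟩
    n * n + (n * c + t) + (cross m + nest m) ∎
    where
    open ≡.≡-Reasoning
    open +-*-Solver
    sumOver-* : ∀ {A : Set} t (f : A → ℕ) {k} (v : Vec A k) → sumOver (λ x → t * f x) v ≡ t * sumOver f v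
    sumOver-* t f []      = ≡.sym (ℕ.*-zeroʳ t)
    sumOver-* t f (x ∷ v) = ≡.trans (cong (t * f x +_) (sumOver-* t f v)) (≡.sym (ℕ.*-distribˡ-+ t _ _))

  -- The left side is the exponent of the sign produced by splitting off the arc `p` in the
  -- expansion of the Pfaffian. The witness `t` counts the arcs nested in `p`.
  before-closer-parity : ∀ {p} {m : Vec (Arc N) n} → Arranged (p ∷ m) → ∃ λ t →
    sumOver (before-closer p) m + pairSum crossing m ≡ pairSum crossing (p ∷ m) + 2 * t
  before-closer-parity {p = p@(a , b)} {m} ((a<b , pre) ∷ _) = t , (begin
    sumOver (before-closer p) m + pairSum crossing m
      ≡⟨ cong (_+ pairSum crossing m) (sumOver-cong (VecAll.map (before-closer-crossing a<b) pre)) ⟩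
    sumOver (λ q → crossing p q + crossing q p + 2 * indicator (proj₂ q <? b)) m + pairSum crossing m
      ≡⟨ cong (_+ pairSum crossing m) (≡.trans (sumOver-+ _ _ m) (cong (u +_) (sumOver-+ g (λ q → g q + 0) m))) ⟩
    u + (sumOver g m + sumOver (λ q → g q + 0) m) + pairSum crossing m
      ≡⟨ cong (λ v → u + (sumOver g m + v) + pairSum crossing m)
           (sumOver-cong (VecAll.universal (λ q → ℕ.+-identityʳ (g q)) m)) ⟩
    u + (t + t) + pairSum crossing m
      ≡⟨ solve 3 (λ u t v → u :+ (t :+ t) :+ v := con 0 :+ u :+ v :+ (t :+ (t :+ con 0))) refl u t (pairSum crossing m) ⟩
    0 + u + pairSum crossing m + 2 * t
      ≡⟨ cong (λ v → v + u + pairSum crossing m + 2 * t) (crossing-self a<b) ⟨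
    crossing p p + u + pairSum crossing m + 2 * t
      ≡⟨ cong (_+ 2 * t) (pairSum-∷ crossing p m) ⟨
    pairSum crossing (p ∷ m) + 2 * t ∎)
    where
    open ≡.≡-Reasoning
    open +-*-Solver
    g = λ q → indicator (proj₂ q <? b)
    t = sumOver g m
    u = sumOver (λ q → crossing p q + crossing q p) m

open Matchings

-- The Pfaffian of a sorted word as a signed sum over matchings.

module Sums {c ℓ} (R : CommutativeRing c ℓ) where
  open CommutativeRing R hiding (zero)
  open RingProperties ring
  open CommutativeSemigroupProperties +-commutativeSemigroup using (x∙yz≈y∙xz)

  ∑ : ∀ {A : Set} → (A → Carrier) → List A → Carrier
  ∑ f xs = foldr _+_ 0# (map f xs)

  ∑-cong : ∀ {A : Set} {f g : A → Carrier} xs → (∀ {x} → x ∈ xs → f x ≈ g x) → ∑ f xs ≈ ∑ g xs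
  ∑-cong []       e = refl
  ∑-cong (x ∷ xs) e = +-cong (e (here ≡.refl)) (∑-cong xs (e ∘ there))

  ∑-map : ∀ {A B : Set} (f : A → Carrier) (h : B → A) xs → ∑ f (map h xs) ≈ ∑ (f ∘ h) xs
  ∑-map f h xs = reflexive (≡.cong (foldr _+_ 0#) (≡.sym (map-∘ xs)))

  ∑-neg : ∀ {A : Set} (f : A → Carrier) xs → ∑ (λ x → - f x) xs ≈ - ∑ f xs
  ∑-neg f []       = sym -0#≈0#
  ∑-neg f (x ∷ xs) = trans (+-congˡ (∑-neg f xs)) (-‿+-comm _ _)

  ∑-*ˡ : ∀ {A : Set} r (f : A → Carrier) xs → ∑ (λ x → r * f x) xs ≈ r * ∑ f xs
  ∑-*ˡ r f []       = sym (zeroʳ r)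
  ∑-*ˡ r f (x ∷ xs) = trans (+-congˡ (∑-*ˡ r f xs)) (sym (distribˡ r _ _))

  ∑-++ : ∀ {A : Set} (f : A → Carrier) xs ys → ∑ f (xs ++ ys) ≈ ∑ f xs + ∑ f ys
  ∑-++ f []       ys = sym (+-identityˡ _)
  ∑-++ f (x ∷ xs) ys = trans (+-congˡ (∑-++ f xs ys)) (sym (+-assoc _ _ _))

  ∑-concatMap : ∀ {A B : Set} (f : A → Carrier) (h : B → List A) xs → ∑ f (concatMap h xs) ≈ ∑ (λ x → ∑ f (h x)) xs
  ∑-concatMap f h []       = refl
  ∑-concatMap f h (x ∷ xs) = trans (∑-++ f (h x) _) (+-congˡ (∑-concatMap f h xs))

  ∑-↭ : ∀ {A : Set} (f : A → Carrier) {xs ys} → xs ↭ ys → ∑ f xs ≈ ∑ f ys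
  ∑-↭ f Perm.refl         = refl
  ∑-↭ f (Perm.prep x p)   = +-congˡ (∑-↭ f p)
  ∑-↭ f (Perm.swap x y p) = trans (+-congˡ (+-congˡ (∑-↭ f p))) (x∙yz≈y∙xz _ _ _)
  ∑-↭ f (Perm.trans p q)  = trans (∑-↭ f p) (∑-↭ f q)

module MatchingSums {c ℓ} (R : CommutativeRing c ℓ) where
  open CommutativeRing R hiding (zero)
  open RingProperties ring
  open Exponentiation semiring
  open CommutativeSemigroupProperties *-commutativeSemigroup using (x∙yz≈y∙xz; interchange)
  open Sums R
  open SetoidReasoning setoid

  weight : ∀ {n N} → (Fin N → Fin N → Carrier) → Vec (Arc N) n → Carrier
  weight a m = foldr _*_ 1# (map (λ (i , j) → a i j) (toList m))

  [-1]^2t : ∀ t → (- 1#) ^ (2 ℕ.* t) ≈ 1#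
  [-1]^2t zero    = refl
  [-1]^2t (suc t) = begin
    (- 1#) ^ (2 ℕ.* suc t)            ≡⟨ ≡.cong ((- 1#) ^_) (ℕ.*-suc 2 t) ⟩
    - 1# * (- 1# * (- 1#) ^ (2 ℕ.* t)) ≈⟨ *-congˡ (*-congˡ ([-1]^2t t)) ⟩
    - 1# * (- 1# * 1#)                 ≈⟨ trans (-1*x≈-x _) (-‿cong (-1*x≈-x _)) ⟩
    - - 1#                             ≈⟨ -‿involutive 1# ⟩
    1#                                 ∎

  module _ {N} (a : Fin N → Fin N → Carrier) where
    open Contraction R (Fin N)
    open WordPfaffian R (Fin N) a

    below : Fin N → List (Fin N) → ℕ
    below b R = ℕ.sum (map (λ x → indicator (x <? b)) R)

    -- In an increasing word, the position of `b` is the number of remaining letters below it.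
    ∂-picks : ∀ g f {L} → Sorted L →
      ∂ g f L ≈ ∑ (λ (b , R) → (- 1#) ^ below b R * (g b * f R)) (picks L)
    ∂-picks g f []              = refl
    ∂-picks g f {y ∷ L} (y< ∷ s) = +-cong
      (sym (trans (*-congʳ (reflexive (≡.cong ((- 1#) ^_) (none y<)))) (*-identityˡ _)))
      (begin
        - ∂ g (f ∘ (y ∷_)) L
          ≈⟨ -‿cong (∂-picks g (f ∘ (y ∷_)) s) ⟩
        - ∑ (λ (b , R) → (- 1#) ^ below b R * (g b * f (y ∷ R))) (picks L)
          ≈⟨ ∑-neg _ (picks L) ⟨
        ∑ (λ (b , R) → - ((- 1#) ^ below b R * (g b * f (y ∷ R)))) (picks L)
          ≈⟨ ∑-cong (picks L) (λ {(b , R)} i → trans (sym (-1*x≈-x _)) (trans (sym (*-assoc _ _ _))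
               (*-congʳ (reflexive (≡.cong ((- 1#) ^_) (≡.sym (below-∷ b R i))))))) ⟩
        ∑ (λ (b , R) → (- 1#) ^ below b (y ∷ R) * (g b * f (y ∷ R))) (picks L)
          ≈⟨ ∑-map _ _ (picks L) ⟨
        ∑ (λ (b , R) → (- 1#) ^ below b R * (g b * f R)) (map (λ (b , R) → b , y ∷ R) (picks L)) ∎)
      where
      none : ∀ {L} → All (y <_) L → below y L ≡ 0
      none []        = ≡.refl
      none (y<x ∷ r) = ≡.cong₂ ℕ._+_ (indicator-no (_ <? y) (Fin.<-asym y<x)) (none r)

      below-∷ : ∀ b R → (b , R) ∈ picks L → below b (y ∷ R) ≡ suc (below b R)
      below-∷ b R i = ≡.cong (ℕ._+ below b R)
        (indicator-yes (y <? b) (All.head (All-resp-↭ (picks-↭ L i) y<)))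

    -- The letters of `R` below `b` are the endpoints of the remaining arcs left of the closer `b`,
    -- so `before-closer-parity` turns the sign of the expansion into the crossing sign.
    pf-matchings : ∀ n {S} → Sorted S →
      pf n S ≈ ∑ (λ m → (- 1#) ^ pairSum crossing m * weight a m) (matchings n S)
    pf-matchings zero    {[]}    s = sym (trans (+-identityʳ _) (*-identityˡ 1#))
    pf-matchings zero    {_ ∷ _} s = refl
    pf-matchings (suc n) {[]}    s = refl
    pf-matchings (suc n) {x ∷ S} xs@(_ ∷ s) = begin
      ∂ (a x) (pf n) S
        ≈⟨ ∂-picks (a x) (pf n) s ⟩
      ∑ (λ (b , R) → (- 1#) ^ below b R * (a x b * pf n R)) (picks S)
        ≈⟨ ∑-cong (picks S) (λ {(b , R)} i → begin
             (- 1#) ^ below b R * (a x b * pf n R)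
               ≈⟨ *-congˡ (*-congˡ (pf-matchings n (sorted-picks S s i))) ⟩
             (- 1#) ^ below b R * (a x b * ∑ term (matchings n R))
               ≈⟨ trans (sym (*-assoc _ _ _)) (sym (∑-*ˡ _ term (matchings n R))) ⟩
             ∑ (λ m → (- 1#) ^ below b R * a x b * term m) (matchings n R)
               ≈⟨ ∑-cong (matchings n R) (λ {m} j → trans (interchange _ _ _ _)
                    (*-congʳ (trans (sym (^-homo-* (- 1#) (below b R) (pairSum crossing m))) (sign-∷ i j)))) ⟩
             ∑ (λ m → term ((x , b) ∷ m)) (matchings n R)
               ≈⟨ ∑-map term ((x , b) ∷_) (matchings n R) ⟨
             ∑ term (map ((x , b) ∷_) (matchings n R)) ∎) ⟩
      ∑ (λ (b , R) → ∑ term (map ((x , b) ∷_) (matchings n R))) (picks S)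
        ≈⟨ ∑-concatMap term _ (picks S) ⟨
      ∑ term (matchings (suc n) (x ∷ S)) ∎
      where
      term : ∀ {n} → Vec (Arc N) n → Carrier
      term m = (- 1#) ^ pairSum crossing m * weight a m

      sign-∷ : ∀ {b R m} → (b , R) ∈ picks S → m ∈ matchings n R →
        (- 1#) ^ (below b R ℕ.+ pairSum crossing m) ≈ (- 1#) ^ pairSum crossing ((x , b) ∷ m)
      sign-∷ {b} {R} {m} i j
        with t , e ← before-closer-parity (isMatchingOf⇒arranged ((x , b) ∷ m) (sorted⇒unique xs)
               (∈-matchings⇒isMatchingOf (suc n) xs (∈-concatMap⁺ _ (Any.map (λ { ≡.refl → ∈-map⁺ _ j }) i))))
        = begin
        (- 1#) ^ (below b R ℕ.+ pairSum crossing m)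
          ≡⟨ ≡.cong (λ r → (- 1#) ^ (r ℕ.+ pairSum crossing m)) (≡.trans (ℕ.sum-↭ (map⁺ _ (↭-sym p)))
               (sumOver-endpoints (λ x → indicator (x <? b)) m)) ⟩
        (- 1#) ^ (sumOver (before-closer (x , b)) m ℕ.+ pairSum crossing m)
          ≡⟨ ≡.cong ((- 1#) ^_) e ⟩
        (- 1#) ^ (pairSum crossing ((x , b) ∷ m) ℕ.+ 2 ℕ.* t)
          ≈⟨ ^-homo-* (- 1#) (pairSum crossing ((x , b) ∷ m)) (2 ℕ.* t) ⟩
        (- 1#) ^ pairSum crossing ((x , b) ∷ m) * (- 1#) ^ (2 ℕ.* t)
          ≈⟨ trans (*-congˡ ([-1]^2t t)) (*-identityʳ _) ⟩
        (- 1#) ^ pairSum crossing ((x , b) ∷ m) ∎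
        where p = proj₂ (proj₂ (∈-matchings⇒isMatchingOf n (sorted-picks S s i) j))

  module _ (λ′ : Carrier) where

    -- Built from folds over mapped lists, so that it unfolds to the very sum in the theorem.
    matchingSum : ∀ n → (Fin (n ℕ.* 2) → Fin (n ℕ.* 2) → Carrier) → Carrier
    matchingSum n B = ∑ (λ m → (- 1#) ^ cross m * λ′ ^ (cross m ℕ.+ nest m) * weight B m) (perfectMatchings n)

    weight-closers : ∀ {n N} {a B : Fin N → Fin N → Carrier} (w : Fin N → ℕ) →
      (∀ {i j} → i < j → a i j ≈ λ′ ^ w j * B i j) → {m : Vec (Arc N) n} → VecAll.All Increasing m →
      weight a m ≈ λ′ ^ sumOver (w ∘ proj₂) m * weight B m
    weight-closers w e []        = sym (*-identityˡ 1#)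
    weight-closers w e {(i , j) ∷ m} (i<j ∷ o) = trans (*-cong (e i<j) (weight-closers w e o))
      (trans (interchange _ _ _ _) (*-congʳ (sym (^-homo-* λ′ (w j) _))))

    pf-weighted : ∀ n (a B : Fin (n ℕ.* 2) → Fin (n ℕ.* 2) → Carrier) (w : Fin (n ℕ.* 2) → ℕ) e →
      (∀ {i j} → i < j → a i j ≈ λ′ ^ w j * B i j) →
      (∀ m → IsPerfectMatching m → sumOver (w ∘ proj₂) m ≡ e ℕ.+ (cross m ℕ.+ nest m)) →
      WordPfaffian.pf R _ a n (allFin (n ℕ.* 2)) ≈ λ′ ^ e * matchingSum n B
    pf-weighted n a B w e h closers = begin
      WordPfaffian.pf R _ a n (allFin (n ℕ.* 2))
        ≈⟨ pf-matchings a n (sorted-allFin _) ⟩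
      ∑ (λ m → (- 1#) ^ pairSum crossing m * weight a m) (matchings n (allFin (n ℕ.* 2)))
        ≈⟨ ∑-↭ _ (↭-sym (perfectMatchings-↭ n)) ⟩
      ∑ (λ m → (- 1#) ^ pairSum crossing m * weight a m) (perfectMatchings n)
        ≈⟨ ∑-cong (perfectMatchings n) (λ {m} i → term m (proj₂ (∈-filter⁻ isPerfectMatching? {xs = allVecs _ n} i))) ⟩
      ∑ (λ m → λ′ ^ e * ((- 1#) ^ cross m * λ′ ^ (cross m ℕ.+ nest m) * weight B m)) (perfectMatchings n)
        ≈⟨ ∑-*ˡ _ _ (perfectMatchings n) ⟩
      λ′ ^ e * matchingSum n B ∎
      where
      term : ∀ m → IsPerfectMatching m → (- 1#) ^ pairSum crossing m * weight a m
        ≈ λ′ ^ e * ((- 1#) ^ cross m * λ′ ^ (cross m ℕ.+ nest m) * weight B m)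
      term m pm@(o , _) = begin
        (- 1#) ^ pairSum crossing m * weight a m
          ≈⟨ *-cong (reflexive (≡.cong ((- 1#) ^_) (≡.sym (cross-pairSum m)))) (weight-closers w h o) ⟩
        (- 1#) ^ cross m * (λ′ ^ sumOver (w ∘ proj₂) m * weight B m)
          ≈⟨ *-congˡ (*-congʳ (trans (reflexive (≡.cong (λ′ ^_) (closers m pm))) (^-homo-* λ′ e _))) ⟩
        (- 1#) ^ cross m * (λ′ ^ e * λ′ ^ (cross m ℕ.+ nest m) * weight B m)
          ≈⟨ *-congˡ (*-assoc _ _ _) ⟩
        (- 1#) ^ cross m * (λ′ ^ e * (λ′ ^ (cross m ℕ.+ nest m) * weight B m))
          ≈⟨ x∙yz≈y∙xz _ _ _ ⟩
        λ′ ^ e * ((- 1#) ^ cross m * (λ′ ^ (cross m ℕ.+ nest m) * weight B m))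
          ≈⟨ *-congˡ (*-assoc _ _ _) ⟨
        λ′ ^ e * ((- 1#) ^ cross m * λ′ ^ (cross m ℕ.+ nest m) * weight B m) ∎

-- Deletion of indices at both ends.

tabulate-last : ∀ {A : Set} {n} (f : Fin (suc n) → A) → tabulate f ≡ tabulate (f ∘ inject₁) ++ f (fromℕ n) ∷ []
tabulate-last {n = zero}  f = ≡.refl
tabulate-last {n = suc n} f = ≡.cong (f zero ∷_) (tabulate-last (f ∘ suc))

punchIn-fromℕ : ∀ {n} (r : Fin n) → punchIn (fromℕ n) r ≡ inject₁ r
punchIn-fromℕ zero    = ≡.refl
punchIn-fromℕ (suc r) = ≡.cong suc (punchIn-fromℕ r)

punchIn-penultimate : ∀ {n} (r : Fin n) → punchIn (inject₁ (fromℕ n)) (inject₁ r) ≡ inject₁ (inject₁ r)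
punchIn-penultimate zero    = ≡.refl
punchIn-penultimate (suc r) = ≡.cong suc (punchIn-penultimate r)

punchIn-penultimate-last : ∀ n → punchIn (inject₁ (fromℕ n)) (fromℕ n) ≡ fromℕ (suc n)
punchIn-penultimate-last zero    = ≡.refl
punchIn-penultimate-last (suc n) = ≡.cong suc (punchIn-penultimate-last n)

-- Only the last position moves, by one; this is the case `t = 1` of `weighted-closers`.
toℕ-punchIn-penultimate : ∀ {n} (r : Fin (suc n)) →
  toℕ (punchIn (inject₁ (fromℕ n)) r) ≡ toℕ r ℕ.+ indicator (r ≟ fromℕ n)
toℕ-punchIn-penultimate {zero}  zero    = ≡.refl
toℕ-punchIn-penultimate {suc n} zero    = ≡.refl
toℕ-punchIn-penultimate {suc n} (suc r) = ≡.cong suc (toℕ-punchIn-penultimate r)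

punchIn-mono-< : ∀ {n} (i : Fin (suc n)) {j k} → j < k → punchIn i j < punchIn i k
punchIn-mono-< i j<k = ℕ.≰⇒> (λ k≤j → ℕ.<⇒≱ j<k (Fin.punchIn-cancel-≤ i _ _ k≤j))

module _ {c ℓ} (D : IntegralDomain c ℓ) where
  open IntegralDomain D hiding (zero)
  open RingProperties ring
  open SetoidReasoning setoid

  cancel-*ˡ : ∀ {x y z} → x ≉ 0# → x * y ≈ x * z → y ≈ z
  cancel-*ˡ {x} {y} {z} x≉0 e with (y - z) ≈? 0#
  ... | yes y-z≈0 = x∙y⁻¹≈ε⇒x≈y y z y-z≈0
  ... | no  y-z≉0 = ⊥-elim (*-nonZero x≉0 y-z≉0 (trans (x[y-z]≈xy-xz x y z) (x≈y⇒x∙y⁻¹≈ε e)))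

submatrix : ∀ {c} {C : Set c} {m n} → (Fin m → Fin n) → (Fin n → Fin n → C) → Fin m → Fin m → C
submatrix σ B i j = B (σ i) (σ j)

StrictlyMonotone : ∀ {m n} → (Fin m → Fin n) → Set
StrictlyMonotone σ = ∀ {i j} → i < j → σ i < σ j

module Deletions (k : ℕ) where
  M : ℕ
  M = k ℕ.* 2

  last pen : Fin (4 ℕ.+ M)
  last = fromℕ (3 ℕ.+ M)
  pen  = inject₁ (fromℕ (2 ℕ.+ M))

  pen′ : Fin (3 ℕ.+ M)
  pen′ = fromℕ (2 ℕ.+ M)

  1st : ∀ {m} → Fin (suc m)
  1st = zero

  2nd : ∀ {m} → Fin (suc (suc m))
  2nd = suc zero

  -- The outermost `delete` in `Pf` acts first on an index. With this order of composition each
  -- minor in the recursion is definitionally a `submatrix`.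
  skip₁₂ skipₚₗ skip₁ₚ skip₂ₗ skip₁ₗ skip₂ₚ : Fin (2 ℕ.+ M) → Fin (4 ℕ.+ M)
  skip₁₂ = punchIn 2nd ∘ punchIn 1st
  skipₚₗ = punchIn last ∘ punchIn pen′
  skip₁ₚ = punchIn pen ∘ punchIn 1st
  skip₂ₗ = punchIn last ∘ punchIn 2nd
  skip₁ₗ = punchIn last ∘ punchIn 1st
  skip₂ₚ = punchIn pen ∘ punchIn 2nd

  skip₁₂ₚₗ : Fin M → Fin (4 ℕ.+ M)
  skip₁₂ₚₗ = punchIn last ∘ punchIn pen′ ∘ punchIn 2nd ∘ punchIn 1st

  skip₁₂-mono : StrictlyMonotone skip₁₂
  skip₁₂-mono = ℕ.s≤s ∘ ℕ.s≤s

  skipₚₗ-mono : StrictlyMonotone skipₚₗ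
  skipₚₗ-mono = punchIn-mono-< last ∘ punchIn-mono-< pen′

  skip₁ₚ-mono : StrictlyMonotone skip₁ₚ
  skip₁ₚ-mono = punchIn-mono-< pen ∘ ℕ.s≤s

  skip₂ₗ-mono : StrictlyMonotone skip₂ₗ
  skip₂ₗ-mono = punchIn-mono-< last ∘ punchIn-mono-< 2nd

  skip₁ₗ-mono : StrictlyMonotone skip₁ₗ
  skip₁ₗ-mono = punchIn-mono-< last ∘ ℕ.s≤s

  skip₂ₚ-mono : StrictlyMonotone skip₂ₚ
  skip₂ₚ-mono = punchIn-mono-< pen ∘ punchIn-mono-< 2nd

  skip₁₂ₚₗ-mono : StrictlyMonotone skip₁₂ₚₗ
  skip₁₂ₚₗ-mono = punchIn-mono-< last ∘ punchIn-mono-< pen′ ∘ punchIn-mono-< 2nd ∘ ℕ.s≤s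

-- The condensation recurrence for matching sums.

module MatchingCondensation {c ℓ} (D : IntegralDomain c ℓ) (λ′ : IntegralDomain.Carrier D)
  (λ≉0 : IntegralDomain._≉_ D λ′ (IntegralDomain.0# D)) where
  open IntegralDomain D hiding (zero)
  open RingProperties ring
  open Exponentiation semiring
  open MatchingSums commutativeRing
  open CommutativeSemigroupProperties *-commutativeSemigroup using (interchange)
  open SetoidReasoning setoid

  ^-nonZero : ∀ n → λ′ ^ n ≉ 0#
  ^-nonZero zero    = 1≉0
  ^-nonZero (suc n) = *-nonZero λ≉0 (^-nonZero n)

  P : ∀ n → (Fin (n ℕ.* 2) → Fin (n ℕ.* 2) → Carrier) → Carrier
  P = matchingSum λ′

  module _ {N} (B : Fin N → Fin N → Carrier) where
    open SkewClosure commutativeRing (λ i j → λ′ ^ toℕ j * B i j) public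
    open WordPfaffian commutativeRing (Fin N) closure public
    open Contraction commutativeRing (Fin N) public using (sign)

    -- The exponent of λ refers to the original index `σ b`. In the uses below, `c` is the number of
    -- deleted indices among the first two, and `t` is 1 when the last index is kept but the
    -- penultimate one deleted. Both only enlarge the power of λ common to all matchings.
    pf-submatrix : ∀ k (σ : Fin (suc k ℕ.* 2) → Fin N) c t →
      StrictlyMonotone σ →
      (∀ {a b} → a < b → toℕ (σ b) ≡ c ℕ.+ toℕ b ℕ.+ t ℕ.* indicator (b ≟ fromℕ (suc (k ℕ.* 2)))) →
      pf (suc k) (tabulate σ)
        ≈ λ′ ^ (suc k ℕ.* suc k ℕ.+ (suc k ℕ.* c ℕ.+ t)) * P (suc k) (submatrix σ B)
    pf-submatrix k σ c t mono pos = begin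
      pf (suc k) (tabulate σ)
        ≡⟨ ≡.cong (pf (suc k)) (map-tabulate id σ) ⟨
      pf (suc k) (map σ (allFin _))
        ≈⟨ WordSubstitution.pf-map commutativeRing σ closure (suc k) (allFin _) ⟩
      WordPfaffian.pf commutativeRing _ (λ i j → closure (σ i) (σ j)) (suc k) (allFin _)
        ≈⟨ pf-weighted λ′ (suc k) _ (submatrix σ B) (toℕ ∘ σ)
             (suc k ℕ.* suc k ℕ.+ (suc k ℕ.* c ℕ.+ t)) (λ i<j → closure-< (mono i<j))
             (weighted-closers c t (toℕ ∘ σ) (fromℕ (suc (k ℕ.* 2))) (λ x → ℕ.≤⇒≯ (Fin.≤fromℕ x)) pos) ⟩
      λ′ ^ (suc k ℕ.* suc k ℕ.+ (suc k ℕ.* c ℕ.+ t)) * P (suc k) (submatrix σ B) ∎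

  P-zero : ∀ B → P 0 B ≈ 1#
  P-zero B = trans (+-identityʳ _) (trans (*-identityʳ _) (*-identityʳ _))

  P-one : ∀ B → P 1 B ≈ B zero (suc zero)
  P-one B = trans (+-identityʳ _) (trans (*-congʳ (*-identityʳ _)) (trans (*-identityˡ _) (*-identityʳ _)))

  module _ (k : ℕ) (B : Fin (4 ℕ.+ k ℕ.* 2) → Fin (4 ℕ.+ k ℕ.* 2) → Carrier) where

    open Deletions k

    private
      minor : ∀ {m} → (Fin m → Fin (4 ℕ.+ M)) → Fin m → Fin m → Carrier
      minor σ = submatrix σ B

      suc² : ∀ {m} → Fin m → Fin (2 ℕ.+ m)
      suc² i = suc (suc i)

      z : Fin M → Fin (4 ℕ.+ M)
      z r = suc (suc (inject₁ (inject₁ r)))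

      Z : List (Fin (4 ℕ.+ M))
      Z = tabulate z

      p q : Fin (4 ℕ.+ M)
      p = pen
      q = last

      pfB : ℕ → List (Fin (4 ℕ.+ M)) → Carrier
      pfB = pf B

      z-last : ∀ r → skip₁₂ₚₗ r ≡ z r
      z-last r = ≡.cong (suc²) (≡.trans (≡.cong (punchIn (fromℕ (suc M))) (punchIn-fromℕ r)) (punchIn-fromℕ (inject₁ r)))

      z-pen : ∀ r → punchIn pen (suc (suc (inject₁ r))) ≡ z r
      z-pen r = ≡.cong (suc²) (punchIn-penultimate r)

      Z≡ : tabulate skip₁₂ₚₗ ≡ Z
      Z≡ = tabulate-cong z-last

      full≡ : tabulate id ≡ zero ∷ suc zero ∷ Z ++ p ∷ q ∷ []
      full≡ = ≡.cong (λ L → zero ∷ suc zero ∷ L) (two-last (suc²))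
        where
        two-last : ∀ {A : Set} {n} (f : Fin (2 ℕ.+ n) → A) →
          tabulate f ≡ tabulate (f ∘ inject₁ ∘ inject₁) ++ f (inject₁ (fromℕ n)) ∷ f (fromℕ (suc n)) ∷ []
        two-last f = ≡.trans (tabulate-last f) (≡.trans
          (≡.cong (_++ _) (tabulate-last (f ∘ inject₁)))
          (++-assoc (tabulate (f ∘ inject₁ ∘ inject₁)) _ _))

      skip₁₂≡ : tabulate skip₁₂ ≡ Z ++ p ∷ q ∷ []
      skip₁₂≡ = ∷-injectiveʳ (∷-injectiveʳ full≡)

      skipₚₗ≡ : tabulate skipₚₗ ≡ zero ∷ suc zero ∷ Z
      skipₚₗ≡ = ≡.cong (λ L → zero ∷ suc zero ∷ L) Z≡

      ends : (σ : Fin (2 ℕ.+ M) → Fin (4 ℕ.+ M)) {x y : Fin (4 ℕ.+ M)} →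
        σ zero ≡ x → (∀ r → σ (suc (inject₁ r)) ≡ z r) → σ (suc (fromℕ M)) ≡ y →
        tabulate σ ≡ x ∷ Z ++ y ∷ []
      ends σ ≡.refl e ≡.refl = ≡.cong (σ zero ∷_)
        (≡.trans (tabulate-last (σ ∘ suc)) (≡.cong (_++ σ (suc (fromℕ M)) ∷ []) (tabulate-cong e)))

      skip₁ₚ≡ : tabulate skip₁ₚ ≡ suc zero ∷ Z ++ q ∷ []
      skip₁ₚ≡ = ends skip₁ₚ ≡.refl z-pen (≡.cong (suc²) (punchIn-penultimate-last M))

      skip₂ₗ≡ : tabulate skip₂ₗ ≡ zero ∷ Z ++ p ∷ []
      skip₂ₗ≡ = ends skip₂ₗ ≡.refl (λ r → ≡.cong (suc²) (punchIn-fromℕ (inject₁ r))) (≡.cong (suc²) (punchIn-fromℕ (fromℕ M)))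

      skip₁ₗ≡ : tabulate skip₁ₗ ≡ suc zero ∷ Z ++ p ∷ []
      skip₁ₗ≡ = ends skip₁ₗ ≡.refl (λ r → ≡.cong (suc²) (punchIn-fromℕ (inject₁ r))) (≡.cong (suc²) (punchIn-fromℕ (fromℕ M)))

      skip₂ₚ≡ : tabulate skip₂ₚ ≡ zero ∷ Z ++ q ∷ []
      skip₂ₚ≡ = ends skip₂ₚ ≡.refl z-pen (≡.cong (suc²) (punchIn-penultimate-last M))

      sign-Z : sign B Z ≈ 1#
      sign-Z = even k z
        where
        even : ∀ k (f : Fin (k ℕ.* 2) → Fin (4 ℕ.+ M)) → sign B (tabulate f) ≈ 1#
        even zero    f = refl
        even (suc k) f = trans (-‿involutive _) (even k (f ∘ suc²))

      toℕ-punchIn-last : ∀ {n} (r : Fin n) → toℕ (punchIn (fromℕ n) r) ≡ toℕ r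
      toℕ-punchIn-last r = ≡.trans (≡.cong toℕ (punchIn-fromℕ r)) (Fin.toℕ-inject₁ r)

      exponent : ℕ → ℕ → ℕ
      exponent c t = suc k ℕ.* suc k ℕ.+ (suc k ℕ.* c ℕ.+ t)

      pf₁₂ : pfB (suc k) (Z ++ p ∷ q ∷ []) ≈ λ′ ^ exponent 2 0 * P (suc k) (minor skip₁₂)
      pf₁₂ = trans (reflexive (≡.cong (pfB (suc k)) (≡.sym skip₁₂≡)))
        (pf-submatrix B k skip₁₂ 2 0 skip₁₂-mono (λ _ → ≡.sym (ℕ.+-identityʳ _)))

      pfₚₗ : pfB (suc k) (zero ∷ suc zero ∷ Z) ≈ λ′ ^ exponent 0 0 * P (suc k) (minor skipₚₗ)
      pfₚₗ = trans (reflexive (≡.cong (pfB (suc k)) (≡.sym skipₚₗ≡)))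
        (pf-submatrix B k skipₚₗ 0 0 skipₚₗ-mono
          (λ {_} {b} _ → ≡.trans (≡.trans (toℕ-punchIn-last _) (toℕ-punchIn-last b)) (≡.sym (ℕ.+-identityʳ _))))

      pf₁ₚ : pfB (suc k) (suc zero ∷ Z ++ q ∷ []) ≈ λ′ ^ exponent 1 1 * P (suc k) (minor skip₁ₚ)
      pf₁ₚ = trans (reflexive (≡.cong (pfB (suc k)) (≡.sym skip₁ₚ≡)))
        (pf-submatrix B k skip₁ₚ 1 1 skip₁ₚ-mono
          (λ {_} {b} _ → ≡.cong suc (≡.trans (toℕ-punchIn-penultimate b) (≡.cong (toℕ b ℕ.+_) (≡.sym (ℕ.+-identityʳ _))))))

      pf₂ₗ : pfB (suc k) (zero ∷ Z ++ p ∷ []) ≈ λ′ ^ exponent 1 0 * P (suc k) (minor skip₂ₗ)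
      pf₂ₗ = trans (reflexive (≡.cong (pfB (suc k)) (≡.sym skip₂ₗ≡)))
        (pf-submatrix B k skip₂ₗ 1 0 skip₂ₗ-mono
          -- Position 0 is not moved by deleting the second index, so the shift by 1 fails there. No
          -- `a` is below it, and only `suc b` remains.
          (λ { {_} {suc b} _ → ≡.trans (toℕ-punchIn-last (suc (suc b))) (≡.sym (ℕ.+-identityʳ _)) }))

      pf₁ₗ : pfB (suc k) (suc zero ∷ Z ++ p ∷ []) ≈ λ′ ^ exponent 1 0 * P (suc k) (minor skip₁ₗ)
      pf₁ₗ = trans (reflexive (≡.cong (pfB (suc k)) (≡.sym skip₁ₗ≡)))
        (pf-submatrix B k skip₁ₗ 1 0 skip₁ₗ-mono
          (λ {_} {b} _ → ≡.trans (toℕ-punchIn-last (suc b)) (≡.sym (ℕ.+-identityʳ _))))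

      pf₂ₚ : pfB (suc k) (zero ∷ Z ++ q ∷ []) ≈ λ′ ^ exponent 1 1 * P (suc k) (minor skip₂ₚ)
      pf₂ₚ = trans (reflexive (≡.cong (pfB (suc k)) (≡.sym skip₂ₚ≡)))
        (pf-submatrix B k skip₂ₚ 1 1 skip₂ₚ-mono
          (λ { {_} {suc b} _ → ≡.cong (2 ℕ.+_) (≡.trans (toℕ-punchIn-penultimate b)
               (≡.cong (toℕ b ℕ.+_) (≡.sym (ℕ.+-identityʳ _)))) }))

      pf-full : pfB (2 ℕ.+ k) (zero ∷ suc zero ∷ Z ++ p ∷ q ∷ [])
        ≈ λ′ ^ ((2 ℕ.+ k) ℕ.* (2 ℕ.+ k) ℕ.+ ((2 ℕ.+ k) ℕ.* 0 ℕ.+ 0)) * P (2 ℕ.+ k) B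
      pf-full = trans (reflexive (≡.cong (pfB (2 ℕ.+ k)) (≡.sym full≡)))
        (pf-submatrix B (suc k) id 0 0 id (λ _ → ≡.sym (ℕ.+-identityʳ _)))

      -- The empty minor is treated apart because `pf-submatrix` refers to a last position.
      pf₁₂ₚₗ : ∀ k (B : Fin (4 ℕ.+ k ℕ.* 2) → Fin (4 ℕ.+ k ℕ.* 2) → Carrier) (σ : Fin (k ℕ.* 2) → Fin (4 ℕ.+ k ℕ.* 2)) →
        StrictlyMonotone σ → (∀ b → toℕ (σ b) ≡ 2 ℕ.+ toℕ b) →
        pf B k (tabulate σ) ≈ λ′ ^ (k ℕ.* k ℕ.+ (k ℕ.* 2 ℕ.+ 0)) * P k (submatrix σ B)
      pf₁₂ₚₗ zero    B σ _    _   = sym (trans (*-identityˡ _) (P-zero (submatrix σ B)))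
      pf₁₂ₚₗ (suc k) B σ mono pos = pf-submatrix B k σ 2 0 mono (λ {_} {b} _ → ≡.trans (pos b) (≡.sym (ℕ.+-identityʳ _)))

      pf-Z : pfB k Z ≈ λ′ ^ (k ℕ.* k ℕ.+ (k ℕ.* 2 ℕ.+ 0)) * P k (minor skip₁₂ₚₗ)
      pf-Z = trans (reflexive (≡.cong (pfB k) (≡.sym Z≡))) (pf₁₂ₚₗ k B skip₁₂ₚₗ skip₁₂ₚₗ-mono
        (λ b → ≡.trans (toℕ-punchIn-last _) (toℕ-punchIn-last _)))

      -- The sum of `k² + 2k`, the exponent for `pf k Z`, and `(k + 2)²`, the exponent for the full
      -- word.
      total : ℕ
      total = 2 ℕ.* (k ℕ.* k) ℕ.+ 6 ℕ.* k ℕ.+ 4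

      combine : ∀ {x y u v} a b → a ℕ.+ b ≡ total → x ≈ λ′ ^ a * u → y ≈ λ′ ^ b * v → x * y ≈ λ′ ^ total * (u * v)
      combine a b e p q = trans (*-cong p q) (trans (interchange _ _ _ _)
        (*-congʳ (trans (sym (^-homo-* λ′ a b)) (reflexive (≡.cong (λ′ ^_) e)))))

      -- For the mixed products the exponents add up to one more than `total`; the surplus factor is
      -- the λ of the recurrence.
      combine-suc : ∀ {x y u v} a b → a ℕ.+ b ≡ suc total → x ≈ λ′ ^ a * u → y ≈ λ′ ^ b * v →
        x * y ≈ λ′ ^ total * (λ′ * u * v)
      combine-suc {x} {y} {u} {v} a b e p q = begin
        x * y                                ≈⟨ *-cong p q ⟩
        (λ′ ^ a * u) * (λ′ ^ b * v)          ≈⟨ interchange _ _ _ _ ⟩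
        (λ′ ^ a * λ′ ^ b) * (u * v)          ≈⟨ *-congʳ (trans (sym (^-homo-* λ′ a b)) (reflexive (≡.cong (λ′ ^_) e))) ⟩
        λ′ * λ′ ^ total * (u * v)            ≈⟨ *-congʳ (*-comm _ _) ⟩
        λ′ ^ total * λ′ * (u * v)            ≈⟨ *-assoc _ _ _ ⟩
        λ′ ^ total * (λ′ * (u * v))          ≈⟨ *-congˡ (*-assoc _ _ _) ⟨
        λ′ ^ total * (λ′ * u * v)            ∎

      open +-*-Solver using (solve; _:=_; _:+_; _:*_; con)

      exponents₀ : k ℕ.* k ℕ.+ (k ℕ.* 2 ℕ.+ 0) ℕ.+ ((2 ℕ.+ k) ℕ.* (2 ℕ.+ k) ℕ.+ ((2 ℕ.+ k) ℕ.* 0 ℕ.+ 0)) ≡ total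
      exponents₀ = solve 1 (λ k →
        k :* k :+ (k :* con 2 :+ con 0) :+ ((con 2 :+ k) :* (con 2 :+ k) :+ ((con 2 :+ k) :* con 0 :+ con 0))
        := con 2 :* (k :* k) :+ con 6 :* k :+ con 4) ≡.refl k

      exponents₁ : exponent 2 0 ℕ.+ exponent 0 0 ≡ total
      exponents₁ = solve 1 (λ k → let k′ = con 1 :+ k in
        k′ :* k′ :+ (k′ :* con 2 :+ con 0) :+ (k′ :* k′ :+ (k′ :* con 0 :+ con 0))
        := con 2 :* (k :* k) :+ con 6 :* k :+ con 4) ≡.refl k

      exponents₂ : exponent 1 1 ℕ.+ exponent 1 0 ≡ suc total
      exponents₂ = solve 1 (λ k → let k′ = con 1 :+ k in
        k′ :* k′ :+ (k′ :* con 1 :+ con 1) :+ (k′ :* k′ :+ (k′ :* con 1 :+ con 0))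
        := con 1 :+ (con 2 :* (k :* k) :+ con 6 :* k :+ con 4)) ≡.refl k

    matchingSum-condensation :
      P k (minor skip₁₂ₚₗ) * P (2 ℕ.+ k) B
        ≈ P (suc k) (minor skip₁₂) * P (suc k) (minor skipₚₗ)
          - λ′ * P (suc k) (minor skip₁ₚ) * P (suc k) (minor skip₂ₗ)
          + λ′ * P (suc k) (minor skip₁ₗ) * P (suc k) (minor skip₂ₚ)
    matchingSum-condensation = cancel-*ˡ D (^-nonZero total) (begin
      λ′ ^ total * (P k (minor skip₁₂ₚₗ) * P (2 ℕ.+ k) B)
        ≈⟨ combine (k ℕ.* k ℕ.+ (k ℕ.* 2 ℕ.+ 0)) _ exponents₀ pf-Z pf-full ⟨
      pfB k Z * pfB (2 ℕ.+ k) (zero ∷ suc zero ∷ Z ++ p ∷ q ∷ [])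
        ≈⟨ pf-condensation k zero (suc zero) Z p q sign-Z ⟩
      pfB (suc k) (Z ++ p ∷ q ∷ []) * pfB (suc k) (zero ∷ suc zero ∷ Z)
        - pfB (suc k) (suc zero ∷ Z ++ q ∷ []) * pfB (suc k) (zero ∷ Z ++ p ∷ [])
        + pfB (suc k) (suc zero ∷ Z ++ p ∷ []) * pfB (suc k) (zero ∷ Z ++ q ∷ [])
        ≈⟨ +-cong (+-cong (combine (exponent 2 0) (exponent 0 0) exponents₁ pf₁₂ pfₚₗ)
             (-‿cong (combine-suc (exponent 1 1) (exponent 1 0) exponents₂ pf₁ₚ pf₂ₗ)))
             (combine-suc (exponent 1 0) (exponent 1 1) (≡.trans (ℕ.+-comm (exponent 1 0) _) exponents₂) pf₁ₗ pf₂ₚ) ⟩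
      λ′ ^ total * u - λ′ ^ total * v + λ′ ^ total * w
        ≈⟨ trans (distribˡ _ _ _) (+-congʳ (x[y-z]≈xy-xz _ _ _)) ⟨
      λ′ ^ total * (u - v + w) ∎)
      where
      open Condensation commutativeRing (Fin (4 ℕ.+ M)) (closure B) (closure-skew B) (closure-diagonal B)
      u v w : Carrier
      u = P (suc k) (minor skip₁₂) * P (suc k) (minor skipₚₗ)
      v = λ′ * P (suc k) (minor skip₁ₚ) * P (suc k) (minor skip₂ₗ)
      w = λ′ * P (suc k) (minor skip₁ₗ) * P (suc k) (minor skip₂ₚ)

-- Transport along ring homomorphisms and nonvanishing at λ = 0.

module MatchingSumHomomorphism {c₁ ℓ₁ c₂ ℓ₂} (S : CommutativeRing c₁ ℓ₁) (T : CommutativeRing c₂ ℓ₂)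
  (ι : CommutativeRing.Carrier S → CommutativeRing.Carrier T)
  (isHom : IsRingHomomorphism (CommutativeRing.rawRing S) (CommutativeRing.rawRing T) ι) where
  private
    module S = CommutativeRing S
    module S^ = Exponentiation S.semiring
    module SumS = Sums S
    module MatchingsS = MatchingSums S
  open CommutativeRing T hiding (zero)
  open Exponentiation semiring
  open Sums T
  open MatchingSums T
  open IsRingHomomorphism isHom

  ^-homo : ∀ x n → ι (x S^.^ n) ≈ ι x ^ n
  ^-homo x zero    = 1#-homo
  ^-homo x (suc n) = trans (*-homo x _) (*-congˡ (^-homo x n))

  ∑-homo : ∀ {A : Set} {f : A → S.Carrier} {g} → (∀ x → ι (f x) ≈ g x) → ∀ xs → ι (SumS.∑ f xs) ≈ ∑ g xs
  ∑-homo e []       = 0#-homo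
  ∑-homo e (x ∷ xs) = trans (+-homo _ _) (+-cong (e x) (∑-homo e xs))

  weight-homo : ∀ {n N} {A : Fin N → Fin N → Carrier} {B : Fin N → Fin N → S.Carrier} →
    (∀ i j → A i j ≈ ι (B i j)) → (m : Vec (Arc N) n) → ι (MatchingsS.weight B m) ≈ weight A m
  weight-homo A≈B []            = 1#-homo
  weight-homo A≈B ((i , j) ∷ m) = trans (*-homo _ _) (*-cong (sym (A≈B i j)) (weight-homo A≈B m))

  matchingSum-homo : ∀ x n {A : Fin (n ℕ.* 2) → Fin (n ℕ.* 2) → Carrier} {B : Fin (n ℕ.* 2) → Fin (n ℕ.* 2) → S.Carrier} →
    (∀ i j → A i j ≈ ι (B i j)) → ι (MatchingsS.matchingSum x n B) ≈ matchingSum (ι x) n A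
  matchingSum-homo x n A≈B = ∑-homo (λ m → trans (*-homo _ _)
    (*-cong (trans (*-homo _ _) (*-cong
               (trans (^-homo _ (cross m)) (^-congˡ (cross m) (trans (-‿homo S.1#) (-‿cong 1#-homo))))
               (^-homo x (cross m ℕ.+ nest m))))
            (weight-homo A≈B m))) (perfectMatchings n)

module NonVanishing {c₁ ℓ₁ c₂ ℓ₂} (D : IntegralDomain c₁ ℓ₁) (E : IntegralDomain c₂ ℓ₂)
  (φ : IntegralDomain.Carrier D → IntegralDomain.Carrier E)
  (isHom : IsRingHomomorphism (IntegralDomain.rawRing D) (IntegralDomain.rawRing E) φ)
  (λ′ : IntegralDomain.Carrier D)
  (λ≉0 : IntegralDomain._≉_ D λ′ (IntegralDomain.0# D))
  (φλ≈0 : IntegralDomain._≈_ E (φ λ′) (IntegralDomain.0# E)) where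
  private module D = IntegralDomain D
  open IntegralDomain E hiding (zero)
  open IsRingHomomorphism isHom
  open RingProperties ring using (-0#≈0#)
  open MatchingCondensation D λ′ λ≉0 using (P; P-zero; P-one; matchingSum-condensation)
  open SetoidReasoning setoid

  Regular : ∀ {m} → (Fin m → Fin m → D.Carrier) → Set ℓ₂
  Regular B = ∀ {i j} → i < j → φ (B i j) ≉ 0#

  -- The image under φ of the condensation identity has only its first term.
  matchingSum-regular : ∀ n B → Regular B → φ (P n B) ≉ 0#
  matchingSum-regular zero B reg e = 1≉0 (trans (sym (trans (⟦⟧-cong (P-zero B)) 1#-homo)) e)
  matchingSum-regular (suc zero) B reg e = reg (ℕ.s≤s ℕ.z≤n) (trans (sym (⟦⟧-cong (P-one B))) e)
  matchingSum-regular (suc (suc k)) B reg e = *-nonZero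
    (matchingSum-regular (suc k) (submatrix skip₁₂ B) (reg ∘ skip₁₂-mono))
    (matchingSum-regular (suc k) (submatrix skipₚₗ B) (reg ∘ skipₚₗ-mono))
    (begin
      φ a * φ b
        ≈⟨ trans (+-identityʳ _) (trans (+-congˡ -0#≈0#) (+-identityʳ _)) ⟨
      φ a * φ b - 0# + 0#
        ≈⟨ +-cong (+-cong (*-homo a b) (-‿cong (λ*-vanishes r d))) (λ*-vanishes f g) ⟨
      φ (a D.* b) - φ (λ′ D.* r D.* d) + φ (λ′ D.* f D.* g)
        ≈⟨ +-congʳ (trans (+-homo _ _) (+-congˡ (-‿homo _))) ⟨
      φ (a D.* b D.- λ′ D.* r D.* d) + φ (λ′ D.* f D.* g)
        ≈⟨ +-homo _ _ ⟨
      φ (a D.* b D.- λ′ D.* r D.* d D.+ λ′ D.* f D.* g)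
        ≈⟨ ⟦⟧-cong (matchingSum-condensation k B) ⟨
      φ (h D.* P (2 ℕ.+ k) B)
        ≈⟨ *-homo h (P (2 ℕ.+ k) B) ⟩
      φ h * φ (P (2 ℕ.+ k) B)
        ≈⟨ trans (*-congˡ e) (zeroʳ _) ⟩
      0# ∎)
    where
    open Deletions k
    a b r d f g h : D.Carrier
    a = P (suc k) (submatrix skip₁₂ B)
    b = P (suc k) (submatrix skipₚₗ B)
    r = P (suc k) (submatrix skip₁ₚ B)
    d = P (suc k) (submatrix skip₂ₗ B)
    f = P (suc k) (submatrix skip₁ₗ B)
    g = P (suc k) (submatrix skip₂ₚ B)
    h = P k (submatrix skip₁₂ₚₗ B)

    λ*-vanishes : ∀ x y → φ (λ′ D.* x D.* y) ≈ 0#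
    λ*-vanishes x y = trans (*-homo _ y)
      (trans (*-congʳ (trans (*-homo λ′ x) (trans (*-congʳ φλ≈0) (zeroˡ _)))) (zeroˡ _))

-- Agreement of the recursive Pfaffian with the matching sum.

module PfaffianFormula {c₁ ℓ₁ c₂ ℓ₂ c₃ ℓ₃}
  (D : IntegralDomain c₁ ℓ₁) (E : IntegralDomain c₂ ℓ₂) (F : Field c₃ ℓ₃)
  (φ : IntegralDomain.Carrier D → IntegralDomain.Carrier E)
  (φ-isHom : IsRingHomomorphism (IntegralDomain.rawRing D) (IntegralDomain.rawRing E) φ)
  (ι : IntegralDomain.Carrier D → Field.Carrier F)
  (ι-isHom : IsRingHomomorphism (IntegralDomain.rawRing D) (Field.rawRing F) ι)
  (ι-≉0 : ∀ {x} → IntegralDomain._≉_ D x (IntegralDomain.0# D) → Field._≉_ F (ι x) (Field.0# F))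
  (λ′ : IntegralDomain.Carrier D)
  (λ≉0 : IntegralDomain._≉_ D λ′ (IntegralDomain.0# D))
  (φλ≈0 : IntegralDomain._≈_ E (φ λ′) (IntegralDomain.0# E)) where
  private
    module D = IntegralDomain D
    module E = IntegralDomain E
    module φ = IsRingHomomorphism φ-isHom
  open Field F hiding (zero)
  open Pfaffian F
  open IsRingHomomorphism ι-isHom
  open CommutativeSemigroupProperties *-commutativeSemigroup using (xy∙z≈xz∙y)
  open NonVanishing D E φ φ-isHom λ′ λ≉0 φλ≈0
  open MatchingCondensation D λ′ λ≉0 using (P; P-zero; P-one; matchingSum-condensation)
  open SetoidReasoning setoid

  /-unique : ∀ {x y z} → y ≉ 0# → x ≈ y * z → x / y ≈ z
  /-unique {x} {y} {z} y≉0 e = begin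
    x * y ⁻¹        ≈⟨ *-congʳ e ⟩
    y * z * y ⁻¹    ≈⟨ xy∙z≈xz∙y y z (y ⁻¹) ⟩
    y * y ⁻¹ * z    ≈⟨ *-congʳ (⁻¹-inverseʳ y≉0) ⟩
    1# * z          ≈⟨ *-identityˡ z ⟩
    z               ∎

  Agrees : ℕ → Set _
  Agrees n = ∀ (A : Matrix (n ℕ.* 2)) (B : Fin (n ℕ.* 2) → Fin (n ℕ.* 2) → D.Carrier) →
    (∀ i j → A i j ≈ ι (B i j)) → Regular B → Pf (ι λ′) n A ≈ ι (P n B)

  -- Once the smaller Pfaffians are replaced by matching sums, condensation shows the numerator to
  -- be `ι h` times the desired value. The division is legitimate because `φ h`, hence `h`, hence
  -- `ι h` is nonzero.
  agrees-suc² : ∀ k → Agrees k → Agrees (suc k) → Agrees (2 ℕ.+ k)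
  agrees-suc² k ihₖ ihₖ₊₁ A B A≈B reg = trans
    (*-cong (+-cong (+-cong (*-cong (minor skip₁₂ skip₁₂-mono) (minor skipₚₗ skipₚₗ-mono))
                            (-‿cong (*-cong (*-congˡ (minor skip₁ₚ skip₁ₚ-mono)) (minor skip₂ₗ skip₂ₗ-mono))))
                    (*-cong (*-congˡ (minor skip₁ₗ skip₁ₗ-mono)) (minor skip₂ₚ skip₂ₚ-mono)))
            (⁻¹-cong denominator))
    (/-unique (ι-≉0 h≉0) (begin
      ι a * ι b - ι λ′ * ι r * ι d + ι λ′ * ι f * ι g
        ≈⟨ +-cong (+-cong (*-homo a b) (-‿cong (triple r d))) (triple f g) ⟨
      ι (a D.* b) - ι (λ′ D.* r D.* d) + ι (λ′ D.* f D.* g)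
        ≈⟨ +-congʳ (trans (+-homo _ _) (+-congˡ (-‿homo _))) ⟨
      ι (a D.* b D.- λ′ D.* r D.* d) + ι (λ′ D.* f D.* g)
        ≈⟨ +-homo _ _ ⟨
      ι (a D.* b D.- λ′ D.* r D.* d D.+ λ′ D.* f D.* g)
        ≈⟨ ⟦⟧-cong (matchingSum-condensation k B) ⟨
      ι (h D.* P (2 ℕ.+ k) B)
        ≈⟨ *-homo h (P (2 ℕ.+ k) B) ⟩
      ι h * ι (P (2 ℕ.+ k) B) ∎))
    where
    open Deletions k

    minor : (σ : Fin (2 ℕ.+ M) → Fin (4 ℕ.+ M)) → StrictlyMonotone σ →
      Pf (ι λ′) (suc k) (submatrix σ A) ≈ ι (P (suc k) (submatrix σ B))
    minor σ mono = ihₖ₊₁ (submatrix σ A) (submatrix σ B) (λ i j → A≈B (σ i) (σ j)) (reg ∘ mono)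

    a b r d f g h : D.Carrier
    a = P (suc k) (submatrix skip₁₂ B)
    b = P (suc k) (submatrix skipₚₗ B)
    r = P (suc k) (submatrix skip₁ₚ B)
    d = P (suc k) (submatrix skip₂ₗ B)
    f = P (suc k) (submatrix skip₁ₗ B)
    g = P (suc k) (submatrix skip₂ₚ B)
    h = P k (submatrix skip₁₂ₚₗ B)

    denominator : Pf (ι λ′) k (submatrix skip₁₂ₚₗ A) ≈ ι h
    denominator = ihₖ (submatrix skip₁₂ₚₗ A) (submatrix skip₁₂ₚₗ B)
      (λ i j → A≈B (skip₁₂ₚₗ i) (skip₁₂ₚₗ j)) (reg ∘ skip₁₂ₚₗ-mono)

    h≉0 : h D.≉ D.0#
    h≉0 e = matchingSum-regular k (submatrix skip₁₂ₚₗ B) (reg ∘ skip₁₂ₚₗ-mono)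
      (E.trans (φ.⟦⟧-cong e) φ.0#-homo)

    triple : ∀ u v → ι (λ′ D.* u D.* v) ≈ ι λ′ * ι u * ι v
    triple u v = trans (*-homo (λ′ D.* u) v) (*-congʳ (*-homo λ′ u))

  Pf-matchingSum : ∀ n → Agrees n
  Pf-matchingSum zero          A B A≈B reg = sym (trans (⟦⟧-cong (P-zero B)) 1#-homo)
  Pf-matchingSum (suc zero)    A B A≈B reg = trans (A≈B zero (suc zero)) (⟦⟧-cong (D.sym (P-one B)))
  Pf-matchingSum (suc (suc k)) = agrees-suc² k (Pf-matchingSum k) (Pf-matchingSum (suc k))

  Pf≈matchingSum : ∀ n {A : Matrix (n ℕ.* 2)} {B : Fin (n ℕ.* 2) → Fin (n ℕ.* 2) → D.Carrier} →
    (∀ i j → A i j ≈ ι (B i j)) → Regular B →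
    Pf (ι λ′) n A ≈ MatchingSums.matchingSum commutativeRing (ι λ′) n A
  Pf≈matchingSum n A≈B reg = trans (Pf-matchingSum n _ _ A≈B reg)
    (MatchingSumHomomorphism.matchingSum-homo D.commutativeRing commutativeRing ι ι-isHom λ′ n A≈B)

-- Polynomials, fractions and the generic matrix.

module ConstantTerm {c ℓ} (E : IntegralDomain c ℓ) where
  private
    module E = IntegralDomain E
    module D = IntegralDomain (Polynomial.integralDomain E)
  open Polynomial E using (Poly; coeff; at)
  open RingProperties E.ring using (-0#≈0#)

  -- In the application λ is the outermost variable of the iterated polynomial ring, so this is
  -- evaluation at λ = 0, with values in the polynomials in the matrix entries.
  const : Poly → E.Carrier
  const p = coeff p 0

  const-+ : ∀ p q → const (p D.+ q) E.≈ const p E.+ const q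
  const-+ []      q       = E.sym (E.+-identityˡ _)
  const-+ (a ∷ p) []      = E.sym (E.+-identityʳ _)
  const-+ (a ∷ p) (b ∷ q) = E.refl

  const-neg : ∀ p → const (D.- p) E.≈ E.- const p
  const-neg []      = E.sym -0#≈0#
  const-neg (a ∷ p) = E.refl

  const-* : ∀ p q → const (p D.* q) E.≈ const p E.* const q
  const-* []      q       = E.sym (E.zeroˡ _)
  const-* (a ∷ p) []      = E.sym (E.zeroʳ a)
  const-* (a ∷ p) (b ∷ q) = E.+-identityʳ _

  const-isRingHomomorphism : IsRingHomomorphism D.rawRing E.rawRing const
  const-isRingHomomorphism = record
    { isSemiringHomomorphism = record
      { isNearSemiringHomomorphism = record
        { +-isMonoidHomomorphism = record
          { isMagmaHomomorphism = record
            { isRelHomomorphism = record { cong = λ e → at e 0 }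
            ; homo = const-+
            }
          ; ε-homo = E.refl
          }
        ; *-homo = const-*
        }
      ; 1#-homo = E.refl
      }
    ; -‿homo = const-neg
    }

module FractionEmbedding {c ℓ} (D : IntegralDomain c ℓ) where
  private module D = IntegralDomain D
  open Fractions D using (fromDomain; fractionField; crossMultiply; cross≈)
  open Field fractionField hiding (zero)

  fromDomain-≉0 : ∀ {x} → x D.≉ D.0# → fromDomain x ≉ 0#
  fromDomain-≉0 {x} x≉0 e = x≉0 (D.trans (D.sym (D.*-identityʳ x)) (D.trans (cross≈ e) (D.*-identityʳ D.0#)))

  fromDomain-isRingHomomorphism : IsRingHomomorphism D.rawRing rawRing fromDomain
  fromDomain-isRingHomomorphism = record
    { isSemiringHomomorphism = record
      { isNearSemiringHomomorphism = record
        { +-isMonoidHomomorphism = record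
          { isMagmaHomomorphism = record
            { isRelHomomorphism = record { cong = λ e → crossMultiply (D.*-congʳ e) }
            ; homo = λ x y → crossMultiply (D.*-cong
                (D.sym (D.+-cong (D.*-identityʳ x) (D.*-identityʳ y))) (D.*-identityˡ D.1#))
            }
          ; ε-homo = crossMultiply D.refl
          }
        ; *-homo = λ x y → crossMultiply (D.*-congˡ (D.*-identityˡ D.1#))
        }
      ; 1#-homo = crossMultiply D.refl
      }
    ; -‿homo = λ x → crossMultiply D.refl
    }

X≉0 : ∀ {N} (i : Fin N) → IntegralDomain._≉_ ℚ[X N ] (X i) (IntegralDomain.0# ℚ[X N ])
X≉0 {suc N} zero    e = IntegralDomain.1≉0 ℚ[X N ] (Polynomial._≈_.at e 1)
X≉0 {suc N} (suc i) e = X≉0 i (Polynomial._≈_.at e 0)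

module GenericFormula (m : ℕ) where
  open Generic m
  open Field RationalFunctions hiding (zero)
  private
    E = ℚ[X #pairs m ]
    D = Polynomial.integralDomain E
    module E = IntegralDomain E
  open Fractions D using (fromDomain; num)
  open ConstantTerm E
  open FractionEmbedding D

  -- Every entry has denominator 1, so its numerator lifts it to the polynomial ring.
  A≈fromDomain-num : ∀ i j → A i j ≈ fromDomain (num (A i j))
  A≈fromDomain-num i j with <-cmp i j
  ... | tri< _ _ _ = refl
  ... | tri≈ _ _ _ = refl
  ... | tri> _ _ _ = refl

  -- Above the diagonal an entry is a variable other than λ, and its constant term in λ is that same
  -- variable.
  const-num-A≉0 : ∀ {i j} → i < j → const (num (A i j)) E.≉ E.0#
  const-num-A≉0 {i} {j} i<j with <-cmp i j
  ... | tri< i<j _ _ = X≉0 {#pairs m} (pairIndex i j i<j)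
  ... | tri≈ i≮j _ _ = ⊥-elim (i≮j i<j)
  ... | tri> i≮j _ _ = ⊥-elim (i≮j i<j)

  open PfaffianFormula D E RationalFunctions const const-isRingHomomorphism
    fromDomain fromDomain-isRingHomomorphism fromDomain-≉0 (X {suc (#pairs m)} zero) (X≉0 {suc (#pairs m)} zero) E.refl public

theorem1 : ∀ (n : ℕ) →
    let open Generic (n ℕ.* 2)
        open Field RationalFunctions
        open Pfaffian RationalFunctions
    in Pf λ′ n A ≈
       sum (map (λ m → (- 1#) ^ cross m * λ′ ^ (cross m ℕ.+ nest m)
                       * product (map (λ (a , b) → A a b) (toList m)))
                (perfectMatchings n))
theorem1 n = Pf≈matchingSum n A≈fromDomain-num const-num-A≉0
  where open GenericFormula (n ℕ.* 2)
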